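{- Let $p\ge q\ge 1$ be integers. The polytope $$P_{p,q}=\{(x,y)\in\mathbb{R}^{\mathcal{I}_{p,q}}\times\mathbb{R}^{A_{p,q}} : y\in F_{p,q},\ (x,y)\text{ satisfies (a) and (b)}\},$$ where (a) is $y_{(i-1,j-1)^{\searrow}}\le x_{ij}$ for all $(i,j)\in\mathcal{I}_{p,q}$, and (b) is $x(\mathrm{bar}_{i,j})\le y(\mathrm{in}^{\searrow}(\mathrm{col}_{i,j}))$ for all $(i,j)\in\mathcal{I}_{p,q}$, is integral, i.e., all its vertices have integer coordinates.
   Context: Notation: $[n]=\{1,\dots,n\}$, $[n]_0=\{0,1,\dots,n\}$, $q(i)=\min\{i,q\}$, $\mathcal{I}_{p,q}=\{(i,j)\in[p]\times[q] : i\ge j\}$. For a vector $z\in\mathbb{R}^M$ and $N\subseteq M$, $z(N)=\sum_{e\in N}z_e$. The directed acyclic graph $D_{p,q}=(V_{p,q},A_{p,q})$ has node set $V_{p,q}=\mathcal{I}_{p,q}\uplus([p]_0\times\{0\})\uplus\{s\}\uplus\{t\}$ and the following arcs: - vertical arcs $(i,j)^{\downarrow}=((i,j),(i+1,j))$ for $i\in[p-1]_0$, $j\in[q(i)]_0$; - diagonal arcs $(i,j)^{\searrow}=((i,j),(i+1,j+1))$ for $i\in[p-1]_0$, $j\in[q(i+1)-1]_0$; - the arc $(s,(0,0))$; - the arcs $((p,j),t)$ for $j\in[q]_0$. $F_{p,q}\subseteq\mathbb{R}^{A_{p,q}}$ is the set of all $s$-$t$-flows in $D_{p,q}$ of flow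 value one without capacity restrictions: $y\ge 0$, flow conservation at every node other than $s,t$, and one unit of flow leaving $s$. For $W\subseteq V_{p,q}$, $\mathrm{in}^{\searrow}(W)$ is the set of diagonal arcs $(u,w)$ with $w\in W$, $u\notin W$. For $(i,j)\in\mathcal{I}_{p,q}$: $\mathrm{bar}_{i,j}=\{(i,\ell)\in\mathcal{I}_{p,q} : \ell\ge j\}$ and $\mathrm{col}_{i,j}=\{(k,j) : j\le k\le i\}$. -}

module Defs where

open import Algebra.Bundles using (CommutativeRing)
open import Algebra.Core using (Op₁; Op₂)
open import Algebra.Structures using (IsCommutativeRing)
import Algebra.Properties.Monoid.Mult as Mult
open import Data.Empty using (⊥)
open import Data.Fin.Base using (Fin; toℕ)
open import Data.Fin.Properties using (toℕ<n; toℕ≤pred[n])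
open import Data.Integer.Base using (ℤ; +_; -[1+_])
open import Data.List.Base
  using (List; _∷_; _++_; map; concatMap; filter; foldr; allFin)
open import Data.Nat.Base
  using (ℕ; suc; pred; _≤_; _<_; _⊓_; z≤n; s≤s; s≤s⁻¹)
open import Data.Nat.Properties
  using (_≟_; _≤?_; ≤-refl; ≤-trans; <⇒≤; n≤1+n; m⊓n≤m; m⊓n≤n; ⊓-glb; ⊓-monoˡ-≤)
open import Data.Product.Base using (∃; _×_; _,_)
open import Data.Sum.Base using (_⊎_; inj₁; inj₂)
open import Data.Unit.Base using (⊤; tt)
open import Function.Base using (_∘_)
open import Level using (Level; _⊔_) renaming (suc to lsuc)
open import Relation.Binary.Core using (Rel)
open import Relation.Binary.Definitions using (DecidableEquality)
open import Relation.Binary.PropositionalEquality using (_≡_; _≢_; refl)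
open import Relation.Binary.Structures using (IsDecTotalOrder)
import Relation.Binary.Construct.NonStrictToStrict as ToStrict
open import Relation.Nullary using (¬_; yes; no; ¬?; _×-dec_)
open import Relation.Unary using (Pred; Decidable)

-- The classical real numbers are an instance; so are the rationals.
record OrderedField c ℓ₁ ℓ₂ : Set (lsuc (c ⊔ ℓ₁ ⊔ ℓ₂)) where
  infix  8 -_
  infixl 7 _*_
  infixl 6 _+_
  infix  4 _≈_ _≤ᶠ_
  field
    Carrier           : Set c
    _≈_               : Rel Carrier ℓ₁
    _≤ᶠ_              : Rel Carrier ℓ₂
    _+_ _*_           : Op₂ Carrier
    -_                : Op₁ Carrier
    0# 1#             : Carrier
    isCommutativeRing : IsCommutativeRing _≈_ _+_ _*_ -_ 0# 1#
    isDecTotalOrder   : IsDecTotalOrder _≈_ _≤ᶠ_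
    1≉0               : ¬ (1# ≈ 0#)
    inverse           : ∀ {x} → ¬ (x ≈ 0#) → ∃ λ y → x * y ≈ 1#
    +-monoʳ-≤         : ∀ x {y z} → y ≤ᶠ z → x + y ≤ᶠ x + z
    *-nonneg          : ∀ {x y} → 0# ≤ᶠ x → 0# ≤ᶠ y → 0# ≤ᶠ x * y

  open ToStrict _≈_ _≤ᶠ_ public using () renaming (_<_ to _<ᶠ_)

  commutativeRing : CommutativeRing c ℓ₁
  commutativeRing = record { isCommutativeRing = isCommutativeRing }

  open Mult (CommutativeRing.+-monoid commutativeRing) public
    using () renaming (_×_ to _·_)

  fromℤ : ℤ → Carrier
  fromℤ (+ n)    = n · 1#
  fromℤ -[1+ n ] = - (suc n · 1#)

module Polyhedra {c ℓ₁ ℓ₂} (K : OrderedField c ℓ₁ ℓ₂) where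
  open OrderedField K

  -- z(N) = Σ_{e ∈ N} z_e, where the list enumerates the finite ground set.
  ∑ : ∀ {m n} {M : Set m} {N : Pred M n} →
      List M → Decidable N → (M → Carrier) → Carrier
  ∑ es N? z = foldr _+_ 0# (map z (filter N? es))

  IsVertex : ∀ {e r} {E : Set e} → Pred (E → Carrier) r → Pred (E → Carrier) _
  IsVertex {E = E} S z = S z ×
    (∀ a b t → S a → S b → 0# <ᶠ t → t <ᶠ 1# →
      (∀ e → z e ≈ t * a e + (1# + - t) * b e) →
      (∀ e → a e ≈ z e) × (∀ e → b e ≈ z e))

  IsIntegerPoint : ∀ {e} {E : Set e} → Pred (E → Carrier) _
  IsIntegerPoint z = ∀ e → ∃ λ (k : ℤ) → z e ≈ fromℤ k

  IsIntegral : ∀ {e r} {E : Set e} → Pred (E → Carrier) r → Set _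
  IsIntegral S = ∀ z → IsVertex S z → IsIntegerPoint z

-- The bounds on coordinates are irrelevant, so that elements of the index
-- sets below are equal as soon as their coordinates are.
module Graph (p q : ℕ) .(q≤p : q ≤ p) where

  record I : Set where
    constructor ⟨_,_⟩
    field
      row col    : ℕ
      .{1≤col}   : 1 ≤ col
      .{col≤row} : col ≤ row
      .{row≤p}   : row ≤ p
      .{col≤q}   : col ≤ q
  open I public using (row; col)

  -- The grid nodes (i , j) with j ≥ 1 form I, those with j = 0 form [p]₀ × {0}.
  data Node : Set where
    grid : (i j : ℕ) → .(i ≤ p) → .(j ≤ i ⊓ q) → Node
    s t  : Node

  data Arc : Set where
    vertical : (i j : ℕ) → .(i < p) → .(j ≤ i ⊓ q) → Arc
    diagonal : (i j : ℕ) → .(i < p) → .(j < suc i ⊓ q) → Arc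
    source   : Arc
    sink     : (j : ℕ) → .(j ≤ q) → Arc

  private
    weaken : ∀ {i j} → j ≤ i ⊓ q → j ≤ suc i ⊓ q
    weaken {i} j≤ = ≤-trans j≤ (⊓-monoˡ-≤ q (n≤1+n i))

    diagTail : ∀ {i j} → j < suc i ⊓ q → j ≤ i ⊓ q
    diagTail {i} j< = ⊓-glb
      (s≤s⁻¹ (≤-trans j< (m⊓n≤m (suc i) q)))
      (<⇒≤ (≤-trans j< (m⊓n≤n (suc i) q)))

    sinkTail : ∀ {j} → q ≤ p → j ≤ q → j ≤ p ⊓ q
    sinkTail q≤p j≤q = ⊓-glb (≤-trans j≤q q≤p) j≤q

  tail : Arc → Node
  tail (vertical i j i<p j≤) = grid i j (<⇒≤ i<p) j≤
  tail (diagonal i j i<p j<) = grid i j (<⇒≤ i<p) (diagTail j<)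
  tail source                = s
  tail (sink j j≤q)          = grid p j ≤-refl (sinkTail q≤p j≤q)

  head : Arc → Node
  head (vertical i j i<p j≤) = grid (suc i) j i<p (weaken j≤)
  head (diagonal i j i<p j<) = grid (suc i) (suc j) i<p j<
  head source                = grid 0 0 z≤n z≤n
  head (sink j j≤q)          = t

  allI : List I
  allI = concatMap (λ i → map (λ j → element i j) (allFin (suc (toℕ i) ⊓ q))) (allFin p)
    where
    element : (i : Fin p) → Fin (suc (toℕ i) ⊓ q) → I
    element i j = record
      { row = suc (toℕ i) ; col = suc (toℕ j)
      ; 1≤col = s≤s z≤n
      ; col≤row = ≤-trans (toℕ<n j) (m⊓n≤m (suc (toℕ i)) q)
      ; row≤p = toℕ<n i
      ; col≤q = ≤-trans (toℕ<n j) (m⊓n≤n (suc (toℕ i)) q) }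

  allArcs : List Arc
  allArcs =
    concatMap (λ i → map (λ j → vertical (toℕ i) (toℕ j) (toℕ<n i) (toℕ≤pred[n] j))
                         (allFin (suc (toℕ i ⊓ q))))
              (allFin p) ++
    concatMap (λ i → map (λ j → diagonal (toℕ i) (toℕ j) (toℕ<n i) (toℕ<n j))
                         (allFin (suc (toℕ i) ⊓ q)))
              (allFin p) ++
    source ∷
    map (λ j → sink (toℕ j) (toℕ≤pred[n] j)) (allFin (suc q))

  _≟ᴺ_ : DecidableEquality Node
  grid i j _ _ ≟ᴺ grid k l _ _ with i ≟ k | j ≟ l
  ... | yes refl | yes refl = yes refl
  ... | no i≢k   | _        = no λ { refl → i≢k refl }
  ... | yes _    | no j≢l   = no λ { refl → j≢l refl }
  grid _ _ _ _ ≟ᴺ s            = no λ ()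
  grid _ _ _ _ ≟ᴺ t            = no λ ()
  s            ≟ᴺ grid _ _ _ _ = no λ ()
  s            ≟ᴺ s            = yes refl
  s            ≟ᴺ t            = no λ ()
  t            ≟ᴺ grid _ _ _ _ = no λ ()
  t            ≟ᴺ s            = no λ ()
  t            ≟ᴺ t            = yes refl

  HasHead HasTail : Node → Pred Arc _
  HasHead v a = head a ≡ v
  HasTail v a = tail a ≡ v

  hasHead? : ∀ v → Decidable (HasHead v)
  hasHead? v a = head a ≟ᴺ v

  hasTail? : ∀ v → Decidable (HasTail v)
  hasTail? v a = tail a ≟ᴺ v

  Bar : I → Pred I _
  Bar e f = row f ≡ row e × col e ≤ col f

  bar? : ∀ e → Decidable (Bar e)
  bar? e f = (row f ≟ row e) ×-dec (col e ≤? col f)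

  Col : I → Pred Node _
  Col e (grid k l _ _) = l ≡ col e × col e ≤ k × k ≤ row e
  Col e s              = ⊥
  Col e t              = ⊥

  col? : ∀ e → Decidable (Col e)
  col? e (grid k l _ _) = (l ≟ col e) ×-dec (col e ≤? k) ×-dec (k ≤? row e)
  col? e s              = no λ ()
  col? e t              = no λ ()

  IsDiagonal : Pred Arc _
  IsDiagonal (diagonal _ _ _ _) = ⊤
  IsDiagonal _                  = ⊥

  isDiagonal? : Decidable IsDiagonal
  isDiagonal? (vertical _ _ _ _) = no λ ()
  isDiagonal? (diagonal _ _ _ _) = yes tt
  isDiagonal? source             = no λ ()
  isDiagonal? (sink _ _)         = no λ ()

  In↘ : ∀ {w} → Pred Node w → Pred Arc w
  In↘ W a = IsDiagonal a × W (head a) × ¬ W (tail a)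

  in↘? : ∀ {w} {W : Pred Node w} → Decidable W → Decidable (In↘ W)
  in↘? W? a = isDiagonal? a ×-dec W? (head a) ×-dec ¬? (W? (tail a))

  private
    pred< : ∀ {i j} → 1 ≤ j → j ≤ i → i ≤ p → pred i < p
    pred< (s≤s _) (s≤s _) i≤p = i≤p

    predBound : ∀ {i j} → 1 ≤ j → j ≤ i → j ≤ q → pred j < suc (pred i) ⊓ q
    predBound (s≤s _) (s≤s j≤i) j≤q = ⊓-glb (s≤s j≤i) j≤q

  -- The arc (i-1 , j-1)↘; here row and col are positive.
  diagonalInto : I → Arc
  diagonalInto (⟨ i , j ⟩ {1≤j} {j≤i} {i≤p} {j≤q}) =
    diagonal (pred i) (pred j) (pred< 1≤j j≤i i≤p) (predBound 1≤j j≤i j≤q)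

module Polytope {c ℓ₁ ℓ₂} (K : OrderedField c ℓ₁ ℓ₂) (p q : ℕ) .(q≤p : q ≤ p) where
  open OrderedField K
  open Polyhedra K
  open Graph p q q≤p

  record F (y : Arc → Carrier) : Set (ℓ₁ ⊔ ℓ₂) where
    field
      nonnegative  : ∀ a → 0# ≤ᶠ y a
      conservation : ∀ v → v ≢ s → v ≢ t →
                     ∑ allArcs (hasHead? v) y ≈ ∑ allArcs (hasTail? v) y
      unit         : ∑ allArcs (hasTail? s) y ≈ 1#

  -- A pair (x , y) in K^I × K^Arc is given as a single point of K^(I ⊎ Arc).
  record P (z : I ⊎ Arc → Carrier) : Set (ℓ₁ ⊔ ℓ₂) where
    x : I → Carrier
    x = z ∘ inj₁
    y : Arc → Carrier
    y = z ∘ inj₂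
    field
      flow   : F y
      boundᵃ : ∀ e → y (diagonalInto e) ≤ᶠ x e
      boundᵇ : ∀ e → ∑ allI (bar? e) x ≤ᶠ ∑ allArcs (in↘? (col? e)) y

{-# OPTIONS --safe #-}
module Submission where

-- Flows of value one in this planar graph are differences of potentials: if
-- u i j is the flow that enters column j in the rows up to i, then u i 0 = 1 and
-- u i j - u (i + 1) (j + 1) and u (i + 1) (j + 1) - u i (j + 1) are the flows on
-- the vertical and the diagonal arc out of (i , j).  Together with the bar sums
-- v of x, u determines the whole point, by differences.
--
-- All values of u lie in [0,1], and nonnegativity of the flow says that u is
-- monotone along certain arcs.  Hence u² and 2u - u², whose average is u, are
-- again potentials of flows, as t ↦ t² and t ↦ 2t - t² are monotone on [0,1] and
-- fix 0 and 1.  In terms of the slacks s = u - v the remaining inequalities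
-- read 0 ≤ s i j ≤ s i (j + 1) + (flow on a vertical arc), so v can be split
-- along with u, by a greedy Riesz decomposition of s.  Therefore u² = u at a
-- vertex, that is, u is 0/1.  With u fixed and 0/1, also v² and 2v - v² satisfy
-- all inequalities, so v is 0/1 as well.

open import Defs
open import Algebra.Bundles using (CommutativeRing)
import Algebra.Properties.Ring as RingProperties
import Algebra.Properties.Semiring.Mult.TCOptimised as Mult
import Algebra.Solver.Ring as RingSolver
open import Algebra.Solver.Ring.AlmostCommutativeRing
  using (fromCommutativeRing; _-Raw-AlmostCommutative⟶_)
open import Data.Empty using (⊥)
open import Data.Fin.Base using (Fin; toℕ; fromℕ<)
open import Data.Fin.Properties using (toℕ<n; toℕ≤pred[n]; toℕ-injective; toℕ-fromℕ<)
open import Data.Integer.Base as ℤ using (ℤ; +_; -[1+_])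
import Data.Integer.Properties as ℤ
open import Data.List.Base using (List; []; _∷_; _++_; map; concatMap; filter; foldr; allFin)
open import Data.List.Membership.Propositional using (_∈_; lose)
import Data.List.Membership.Propositional.Properties as ∈
open import Data.List.Membership.Propositional.Properties.WithK using (unique∧set⇒bag)
open import Data.List.Relation.Binary.BagAndSetEquality using (∼bag⇒↭)
open import Data.List.Relation.Binary.Permutation.Propositional using (↭⇒↭ₛ′)
import Data.List.Relation.Binary.Permutation.Propositional.Properties as ↭
import Data.List.Relation.Binary.Permutation.Setoid.Properties as ↭ₛ
open import Data.List.Relation.Unary.All as All using ([]; _∷_)
import Data.List.Relation.Unary.All.Properties as All
open import Data.List.Relation.Unary.AllPairs as AllPairs using ([]; _∷_)
import Data.List.Relation.Unary.AllPairs.Properties as AllPairs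
open import Data.List.Relation.Unary.Any as Any using (here; there)
open import Data.List.Relation.Unary.Unique.Propositional using (Unique)
import Data.List.Relation.Unary.Unique.Propositional.Properties as Unique
open import Data.Maybe.Base using (Maybe; just; nothing)
open import Data.Nat.Base as ℕ using (ℕ; zero; suc; pred; _≤_; _<_; _⊓_; z≤n; s≤s)
open import Data.Nat.Properties as ℕ using (_≤?_; _<?_)
open import Data.Product.Base using (∃; ∃₂; _×_; _,_; proj₁; proj₂)
import Data.Sign.Base as Sign
open import Data.Sum.Base using (_⊎_; inj₁; inj₂)
open import Data.Unit.Base using (tt)
open import Function.Base using (_∘_)
open import Function.Bundles using (mk⇔)
open import Level using (_⊔_)
open import Relation.Binary.PropositionalEquality as ≡ using (_≡_; _≢_)
open import Relation.Binary.Structures using (IsDecTotalOrder)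
open import Relation.Nullary using (¬_; Dec; yes; no; recompute; contradiction; _×-dec_)
open import Relation.Unary using (Pred; Decidable)

-- Unlike the elements of an abstract ring, integer coefficients have a
-- computing equality, so that the solver can cancel terms.
module IntegerCoefficients {c ℓ} (R : CommutativeRing c ℓ) where
  open CommutativeRing R
  open RingProperties ring
  open Mult semiring using (×-homo-+; ×1-homo-*; 1+×) renaming (_×_ to _·_)
  open import Relation.Binary.Reasoning.Setoid setoid

  private
    ⟦_⟧ : ℤ → Carrier
    ⟦ + n      ⟧ = n · 1#
    ⟦ -[1+ n ] ⟧ = - (suc n · 1#)

    ⟦⟧-neg : ∀ i → ⟦ ℤ.- i ⟧ ≈ - ⟦ i ⟧
    ⟦⟧-neg (+ zero)  = sym -0#≈0#
    ⟦⟧-neg (+ suc n) = refl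
    ⟦⟧-neg -[1+ n ]  = sym (-‿involutive _)

    ⟦⟧-⊖ : ∀ m n → ⟦ m ℤ.⊖ n ⟧ ≈ m · 1# - n · 1#
    ⟦⟧-⊖ m       zero    = sym (trans (+-congˡ -0#≈0#) (+-identityʳ _))
    ⟦⟧-⊖ zero    (suc n) = sym (+-identityˡ _)
    ⟦⟧-⊖ (suc m) (suc n) = begin
      ⟦ suc m ℤ.⊖ suc n ⟧                 ≡⟨ ≡.cong ⟦_⟧ (ℤ.[1+m]⊖[1+n]≡m⊖n m n) ⟩
      ⟦ m ℤ.⊖ n ⟧                         ≈⟨ ⟦⟧-⊖ m n ⟩
      m · 1# - n · 1#                     ≈⟨ +-congʳ (+-identityʳ _) ⟨
      m · 1# + 0# - n · 1#                ≈⟨ +-congʳ (+-congˡ (-‿inverseʳ 1#)) ⟨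
      m · 1# + (1# - 1#) - n · 1#         ≈⟨ +-congʳ (+-assoc _ _ _) ⟨
      m · 1# + 1# - 1# - n · 1#           ≈⟨ +-assoc _ _ _ ⟩
      m · 1# + 1# + (- 1# - n · 1#)       ≈⟨ +-cong (+-comm _ _) (-‿+-comm _ _) ⟩
      1# + m · 1# - (1# + n · 1#)         ≈⟨ +-cong (1+× m 1#) (-‿cong (1+× n 1#)) ⟨
      suc m · 1# - suc n · 1#             ∎

    ⟦⟧-+ : ∀ i j → ⟦ i ℤ.+ j ⟧ ≈ ⟦ i ⟧ + ⟦ j ⟧
    ⟦⟧-+ (+ m)    (+ n)    = ×-homo-+ 1# m n
    ⟦⟧-+ (+ m)    -[1+ n ] = ⟦⟧-⊖ m (suc n)
    ⟦⟧-+ -[1+ m ] (+ n)    = trans (⟦⟧-⊖ n (suc m)) (+-comm _ _)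
    ⟦⟧-+ -[1+ m ] -[1+ n ] = begin
      - (suc (suc m ℕ.+ n) · 1#)      ≡⟨ ≡.cong (λ k → - (k · 1#)) (ℕ.+-suc (suc m) n) ⟨
      - ((suc m ℕ.+ suc n) · 1#)      ≈⟨ -‿cong (×-homo-+ 1# (suc m) (suc n)) ⟩
      - (suc m · 1# + suc n · 1#)     ≈⟨ -‿+-comm _ _ ⟨
      - (suc m · 1#) - (suc n · 1#)   ∎

    ⟦⟧-neg-* : ∀ m n → ⟦ Sign.- ℤ.◃ (m ℕ.* n) ⟧ ≈ - (m · 1# * n · 1#)
    ⟦⟧-neg-* m n = begin
      ⟦ Sign.- ℤ.◃ (m ℕ.* n) ⟧  ≡⟨ ≡.cong ⟦_⟧ (ℤ.-◃n≡-n (m ℕ.* n)) ⟩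
      ⟦ ℤ.- (+ (m ℕ.* n)) ⟧      ≈⟨ ⟦⟧-neg (+ (m ℕ.* n)) ⟩
      - ((m ℕ.* n) · 1#)         ≈⟨ -‿cong (×1-homo-* m n) ⟩
      - (m · 1# * n · 1#)        ∎

    ⟦⟧-* : ∀ i j → ⟦ i ℤ.* j ⟧ ≈ ⟦ i ⟧ * ⟦ j ⟧
    ⟦⟧-* (+ m)    (+ n)    = trans (reflexive (≡.cong ⟦_⟧ (ℤ.+◃n≡+n (m ℕ.* n)))) (×1-homo-* m n)
    ⟦⟧-* (+ m)    -[1+ n ] = trans (⟦⟧-neg-* m (suc n)) (-‿distribʳ-* _ _)
    ⟦⟧-* -[1+ m ] (+ n)    = trans (⟦⟧-neg-* (suc m) n) (-‿distribˡ-* _ _)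
    ⟦⟧-* -[1+ m ] -[1+ n ] = begin
      (suc m ℕ.* suc n) · 1#           ≈⟨ ×1-homo-* (suc m) (suc n) ⟩
      suc m · 1# * suc n · 1#          ≈⟨ -‿involutive _ ⟨
      - - (suc m · 1# * suc n · 1#)    ≈⟨ -‿cong (-‿distribˡ-* _ _) ⟩
      - (- (suc m · 1#) * suc n · 1#)  ≈⟨ -‿distribʳ-* _ _ ⟩
      - (suc m · 1#) * - (suc n · 1#)  ∎

    homomorphism : ℤ.+-*-rawRing -Raw-AlmostCommutative⟶ fromCommutativeRing R
    homomorphism = record
      { ⟦_⟧    = ⟦_⟧
      ; +-homo = ⟦⟧-+
      ; *-homo = ⟦⟧-*
      ; -‿homo = ⟦⟧-neg
      ; 0-homo = refl
      ; 1-homo = refl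
      }

    _≟_ : ∀ i j → Maybe (⟦ i ⟧ ≈ ⟦ j ⟧)
    i ≟ j with i ℤ.≟ j
    ... | no  _   = nothing
    ... | yes i≡j = just (reflexive (≡.cong ⟦_⟧ i≡j))

  open RingSolver ℤ.+-*-rawRing (fromCommutativeRing R) homomorphism _≟_ public

-- Ordered fields

module OrderedFieldProperties {c ℓ₁ ℓ₂} (K : OrderedField c ℓ₁ ℓ₂) where
  open OrderedField K
  open CommutativeRing commutativeRing public using
    ( _-_; setoid; isEquivalence; refl; sym; trans
    ; +-cong; +-congˡ; +-congʳ; *-cong; *-congˡ; *-congʳ; -‿cong
    ; +-identityˡ; +-identityʳ; -‿inverseʳ; *-identityˡ; *-identityʳ; zeroˡ
    ; +-isCommutativeMonoid )
  open IsDecTotalOrder isDecTotalOrder public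
    using (_≟_; total; antisym; ≤-respʳ-≈; ≤-respˡ-≈)
    renaming (refl to ≤ᶠ-refl; trans to ≤ᶠ-trans)
  open IntegerCoefficients commutativeRing public
    using (Polynomial; solve; _:+_; _:*_; _:-_; :-_; con; _:=_)
  open import Relation.Binary.Reasoning.Setoid setoid

  :0 :1 : ∀ {n} → Polynomial n
  :0 = con (+ 0)
  :1 = con (+ 1)

  Nonneg : Carrier → Set ℓ₂
  Nonneg x = 0# ≤ᶠ x

  Nonneg-resp : ∀ {x y} → x ≈ y → Nonneg x → Nonneg y
  Nonneg-resp = ≤-respʳ-≈

  0-nonneg : Nonneg 0#
  0-nonneg = ≤ᶠ-refl

  ≈0⇒nonneg : ∀ {x} → x ≈ 0# → Nonneg x
  ≈0⇒nonneg x≈0 = Nonneg-resp (sym x≈0) 0-nonneg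

  ≤⇒nonneg : ∀ {x y} → x ≤ᶠ y → Nonneg (y - x)
  ≤⇒nonneg {x} {y} x≤y = ≤-respˡ-≈ (solve 1 (λ x → :- x :+ x := :0) refl x)
    (≤-respʳ-≈ (solve 2 (λ x y → :- x :+ y := y :- x) refl x y) (+-monoʳ-≤ (- x) x≤y))

  nonneg⇒≤ : ∀ {x y} → Nonneg (y - x) → x ≤ᶠ y
  nonneg⇒≤ {x} {y} 0≤y-x = ≤-respˡ-≈ (+-identityʳ x)
    (≤-respʳ-≈ (solve 2 (λ x y → x :+ (y :- x) := y) refl x y) (+-monoʳ-≤ x 0≤y-x))

  +-nonneg : ∀ {x y} → Nonneg x → Nonneg y → Nonneg (x + y)
  +-nonneg {x} 0≤x 0≤y = ≤ᶠ-trans 0≤x (≤-respˡ-≈ (+-identityʳ x) (+-monoʳ-≤ x 0≤y))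

  1-nonneg : Nonneg 1#
  1-nonneg with total 0# 1#
  ... | inj₁ 0≤1 = 0≤1
  ... | inj₂ 1≤0 = Nonneg-resp
    (solve 0 ((:0 :- :1) :* (:0 :- :1) := :1) refl)
    (*-nonneg (≤⇒nonneg 1≤0) (≤⇒nonneg 1≤0))

  1≰0 : ¬ (1# ≤ᶠ 0#)
  1≰0 1≤0 = 1≉0 (antisym 1≤0 1-nonneg)

  half : ∃ λ h → h + h ≈ 1#
  -- Adding 1 to 0 ≤ 1 gives 1 ≤ 2, so 2 ≈ 0 would force 1 ≤ 0.
  half with inverse {1# + 1#} (λ 2≈0 → 1≰0
    (≤-respʳ-≈ 2≈0 (≤-respˡ-≈ (+-identityʳ 1#) (+-monoʳ-≤ 1# 1-nonneg))))
  ... | h , 2h≈1 = h , trans (solve 1 (λ h → h :+ h := (:1 :+ :1) :* h) refl h) 2h≈1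

  h : Carrier
  h = proj₁ half

  0<h : 0# <ᶠ h
  0<h = 0≤h (total 0# h) , λ 0≈h → 1≉0 (trans (sym (proj₂ half))
    (trans (+-cong (sym 0≈h) (sym 0≈h)) (+-identityʳ 0#)))
    where
    0≤h : 0# ≤ᶠ h ⊎ h ≤ᶠ 0# → 0# ≤ᶠ h
    0≤h (inj₁ 0≤h) = 0≤h
    0≤h (inj₂ h≤0) = contradiction (nonneg⇒≤ {1#} (Nonneg-resp
      (trans (solve 1 (λ h → (:0 :- h) :+ (:0 :- h) := :0 :- (h :+ h)) refl h)
        (+-congˡ (-‿cong (proj₂ half))))
      (+-nonneg (≤⇒nonneg h≤0) (≤⇒nonneg h≤0)))) 1≰0

  1-h≈h : 1# + - h ≈ h
  1-h≈h = trans (+-congʳ (sym (proj₂ half))) (solve 1 (λ h → h :+ h :- h := h) refl h)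

  h<1 : h <ᶠ 1#
  h<1 = nonneg⇒≤ (Nonneg-resp (sym 1-h≈h) (proj₁ 0<h)) , λ h≈1 → proj₂ 0<h
    (sym (trans (sym 1-h≈h) (trans (+-congˡ (-‿cong h≈1)) (-‿inverseʳ 1#))))

  -- Puts an average into the shape of the convex combinations in `IsVertex`, with coefficient `h`.
  midpoint : ∀ {x a b} → a + b ≈ x + x → x ≈ h * a + (1# + - h) * b
  midpoint {x} {a} {b} a+b≈2x = sym (begin
    h * a + (1# + - h) * b ≈⟨ +-congˡ (*-congʳ 1-h≈h) ⟩
    h * a + h * b          ≈⟨ solve 3 (λ h a b → h :* a :+ h :* b := h :* (a :+ b)) refl h a b ⟩
    h * (a + b)            ≈⟨ *-congˡ a+b≈2x ⟩
    h * (x + x)            ≈⟨ solve 2 (λ h x → h :* (x :+ x) := (h :+ h) :* x) refl h x ⟩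
    (h + h) * x            ≈⟨ *-congʳ (proj₂ half) ⟩
    1# * x                 ≈⟨ *-identityˡ x ⟩
    x                      ∎)

  IsBit : Carrier → Set ℓ₁
  IsBit x = x ≈ 0# ⊎ x ≈ 1#

  -- A nonzero idempotent can be cancelled, by multiplying with its inverse.
  idempotent⇒bit : ∀ {x} → x * x ≈ x → IsBit x
  idempotent⇒bit {x} x²≈x with x ≟ 0#
  ... | yes x≈0 = inj₁ x≈0
  ... | no  x≉0 with y , xy≈1 ← inverse x≉0 = inj₂ (begin
    x           ≈⟨ *-identityʳ x ⟨
    x * 1#      ≈⟨ *-congˡ xy≈1 ⟨
    x * (x * y) ≈⟨ solve 2 (λ x y → x :* (x :* y) := (x :* x) :* y) refl x y ⟩
    x * x * y   ≈⟨ *-congʳ x²≈x ⟩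
    x * y       ≈⟨ xy≈1 ⟩
    1#          ∎)

  difference-≈0 : ∀ {x y} → x ≈ 0# → y ≈ 0# → x - y ≈ 0#
  difference-≈0 x≈0 y≈0 = trans (+-cong x≈0 (-‿cong y≈0)) (-‿inverseʳ 0#)

  difference-≈1 : ∀ {x y} → x ≈ 1# → y ≈ 0# → x - y ≈ 1#
  difference-≈1 x≈1 y≈0 = trans (+-cong x≈1 (-‿cong y≈0)) (solve 0 (:1 :- :0 := :1) refl)

  bits-difference-integer : ∀ {x y} → IsBit x → IsBit y → ∃ λ k → x - y ≈ fromℤ k
  bits-difference-integer (inj₁ x≈0) (inj₁ y≈0) = + 0 , difference-≈0 x≈0 y≈0
  bits-difference-integer (inj₂ x≈1) (inj₂ y≈1) = + 0 ,
    trans (+-cong x≈1 (-‿cong y≈1)) (-‿inverseʳ 1#)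
  bits-difference-integer (inj₂ x≈1) (inj₁ y≈0) = + 1 ,
    trans (difference-≈1 x≈1 y≈0) (sym (+-identityʳ 1#))
  bits-difference-integer (inj₁ x≈0) (inj₂ y≈1) = -[1+ 0 ] , trans (+-cong x≈0 (-‿cong y≈1))
    (solve 0 (:0 :- :1 := :- (:1 :+ :0)) refl)

  -- The choice is recorded by a propositional equality, so that matching on it replaces the minimum
  -- in a goal by the chosen argument.
  min : ∀ x y → ∃ λ m → m ≤ᶠ x × m ≤ᶠ y × (m ≡ x ⊎ m ≡ y)
  min x y with total x y
  ... | inj₁ x≤y = x , ≤ᶠ-refl , x≤y , inj₁ ≡.refl
  ... | inj₂ y≤x = y , y≤x , ≤ᶠ-refl , inj₂ ≡.refl

  bits-difference-bit : ∀ {x y} → IsBit x → IsBit y → Nonneg (x - y) → IsBit (x - y)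
  bits-difference-bit (inj₁ x≈0) (inj₁ y≈0) _ = inj₁ (difference-≈0 x≈0 y≈0)
  bits-difference-bit (inj₂ x≈1) (inj₁ y≈0) _ = inj₂ (difference-≈1 x≈1 y≈0)
  bits-difference-bit (inj₂ x≈1) (inj₂ y≈1) _ = inj₁
    (trans (+-cong x≈1 (-‿cong y≈1)) (-‿inverseʳ 1#))
  bits-difference-bit (inj₁ x≈0) (inj₂ y≈1) 0≤x-y = contradiction
    (nonneg⇒≤ (Nonneg-resp (+-cong x≈0 (-‿cong y≈1)) 0≤x-y)) 1≰0

  double : Carrier → Carrier
  double x = x + x

  -- Equals 1 - (1 - x)², that is, squaring conjugated by the reflection x ↦ 1 - x.
  dual-square : Carrier → Carrier
  dual-square x = double x - x * x

  squares-average : ∀ x → x * x + dual-square x ≈ x + x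
  squares-average = solve 1 (λ x → x :* x :+ (x :+ x :- x :* x) := x :+ x) refl

  square-nonneg : ∀ {x y} → Nonneg x → Nonneg y → Nonneg (x - y) → Nonneg (x * x - y * y)
  square-nonneg 0≤x 0≤y 0≤x-y = Nonneg-resp
    (solve 2 (λ x y → (x :- y) :* (x :+ y) := x :* x :- y :* y) refl _ _)
    (*-nonneg 0≤x-y (+-nonneg 0≤x 0≤y))

  dual-square-nonneg : ∀ {x y} → Nonneg (1# - x) → Nonneg (1# - y) → Nonneg (x - y) →
                       Nonneg (dual-square x - dual-square y)
  dual-square-nonneg x≤1 y≤1 0≤x-y = Nonneg-resp
    (solve 2 (λ x y → (x :- y) :* ((:1 :- x) :+ (:1 :- y)) :=
                      (x :+ x :- x :* x) :- (y :+ y :- y :* y)) refl _ _)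
    (*-nonneg 0≤x-y (+-nonneg x≤1 y≤1))

  square-cong : ∀ {x y} → x ≈ y → x * x ≈ y * y
  square-cong x≈y = *-cong x≈y x≈y

  dual-square-cong : ∀ {x y} → x ≈ y → dual-square x ≈ dual-square y
  dual-square-cong x≈y = +-cong (+-cong x≈y x≈y) (-‿cong (square-cong x≈y))

  0²≈0 : 0# * 0# ≈ 0#
  0²≈0 = zeroˡ 0#

  1²≈1 : 1# * 1# ≈ 1#
  1²≈1 = *-identityˡ 1#

  dual-square-0≈0 : dual-square 0# ≈ 0#
  dual-square-0≈0 = solve 0 (:0 :+ :0 :- :0 :* :0 := :0) refl

  dual-square-1≈1 : dual-square 1# ≈ 1#
  dual-square-1≈1 = solve 0 (:1 :+ :1 :- :1 :* :1 := :1) refl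

  bit⇒idempotent : ∀ {x} → IsBit x → x * x ≈ x
  bit⇒idempotent (inj₁ x≈0) = trans (square-cong x≈0) (trans 0²≈0 (sym x≈0))
  bit⇒idempotent (inj₂ x≈1) = trans (square-cong x≈1) (trans 1²≈1 (sym x≈1))

-- Sums over enumerated finite sets

private
  variable
    m n : ℕ

fromℕ<-view : m < n → ∃ λ (k : Fin n) → toℕ k ≡ m
fromℕ<-view m<n = fromℕ< m<n , toℕ-fromℕ< m<n

module _ {a} {A : Set a} {bound : Fin n → ℕ} (f : ∀ i → Fin (bound i) → A) where

  private
    fibre : Fin n → List A
    fibre i = map (f i) (allFin (bound i))

  -- `allI` and the doubly indexed blocks of `allArcs` are instances of this nested list by
  -- definition.
  enumeration : List A
  enumeration = concatMap fibre (allFin n)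

  ∈-enumeration : ∀ i j → f i j ∈ enumeration
  ∈-enumeration i j = ∈.∈-concatMap⁺ _ (lose (∈.∈-allFin i) (∈.∈-map⁺ (f i) (∈.∈-allFin j)))

  ∈-enumeration⁻ : ∀ {e} → e ∈ enumeration → ∃₂ λ i j → e ≡ f i j
  ∈-enumeration⁻ e∈
    with i , e∈fibre ← Any.satisfied (∈.∈-concatMap⁻ fibre {xs = allFin n} e∈)
    with j , _ , e≡fij ← ∈.∈-map⁻ (f i) e∈fibre = i , j , e≡fij

  -- Second indices are compared as natural numbers, because their `Fin` types depend on the first
  -- index. Injectivity makes each fibre free of repetitions and different fibres disjoint.
  enumeration-unique : (∀ {i j k l} → f i j ≡ f k l → i ≡ k × toℕ j ≡ toℕ l) →
                       Unique enumeration
  enumeration-unique f-injective = Unique.concat⁺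
    (All.map⁺ (All.tabulate λ {i} _ →
      Unique.map⁺ (toℕ-injective ∘ proj₂ ∘ f-injective) (Unique.allFin⁺ (bound i))))
    (AllPairs.map⁺ (AllPairs.map disjoint (Unique.allFin⁺ n)))
    where
    disjoint : ∀ {i k} → i ≢ k → ∀ {e} → ¬ (e ∈ fibre i × e ∈ fibre k)
    disjoint {i} {k} i≢k (e∈i , e∈k)
      with _ , _ , e≡fij ← ∈.∈-map⁻ (f i) e∈i
      with _ , _ , e≡fkl ← ∈.∈-map⁻ (f k) e∈k =
      i≢k (proj₁ (f-injective (≡.trans (≡.sym e≡fij) e≡fkl)))

module Sums {c ℓ₁ ℓ₂} (K : OrderedField c ℓ₁ ℓ₂) where
  open OrderedField K
  open OrderedFieldProperties K
  open Polyhedra K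

  ∑-list : ∀ {m} {M : Set m} → List M → (M → Carrier) → Carrier
  ∑-list es z = foldr _+_ 0# (map z es)

  module _ {m} {M : Set m} {es : List M} (es! : Unique es) (complete : ∀ e → e ∈ es) where

    -- Two lists without repetitions that have the same elements are permutations of each other, and
    -- addition is commutative. Hence a filtered sum can be computed from any explicit list of the
    -- selected elements.
    ∑-enumerate : ∀ {n} {N : Pred M n} (N? : Decidable N) {L : List M} → Unique L →
                  (∀ {e} → N e → e ∈ L) → (∀ {e} → e ∈ L → N e) →
                  ∀ z → ∑ es N? z ≈ ∑-list L z
    ∑-enumerate N? L! N⇒∈ ∈⇒N z = ↭ₛ.foldr-commMonoid setoid +-isCommutativeMonoid
      (↭⇒↭ₛ′ isEquivalence (↭.map⁺ z (∼bag⇒↭ (unique∧set⇒bag (Unique.filter⁺ N? es!) L! (mk⇔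
        (λ e∈ → N⇒∈ (proj₂ (∈.∈-filter⁻ N? {xs = es} e∈)))
        (λ e∈L → ∈.∈-filter⁺ N? (complete _) (∈⇒N e∈L)))))))

    -- Uses the explicit list that puts `e` in front of the filtered list of the smaller set.
    ∑-insert : ∀ {n n′} {N : Pred M n} {N′ : Pred M n′}
               (N? : Decidable N) (N′? : Decidable N′) (e : M) →
               ¬ N′ e → N e → (∀ {a} → N′ a → N a) → (∀ {a} → N a → a ≡ e ⊎ N′ a) →
               ∀ z → ∑ es N? z ≈ z e + ∑ es N′? z
    ∑-insert N? N′? e e∉N′ e∈N N′⊆N N⊆ z = ∑-enumerate N?
      (All.tabulate (λ a∈ e≡a → e∉N′ (≡.subst _ (≡.sym e≡a) (filtered a∈)))
        ∷ Unique.filter⁺ N′? es!)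
      (λ Na → to (N⊆ Na))
      (λ { (here ≡.refl) → e∈N ; (there a∈) → N′⊆N (filtered a∈) })
      z
      where
      filtered : ∀ {a} → a ∈ filter N′? es → _
      filtered a∈ = proj₂ (∈.∈-filter⁻ N′? {xs = es} a∈)
      to : ∀ {a} → a ≡ e ⊎ _ → a ∈ e ∷ filter N′? es
      to (inj₁ ≡.refl) = here ≡.refl
      to (inj₂ N′a)  = there (∈.∈-filter⁺ N′? (complete _) N′a)

    ∑-same : ∀ {n n′} {N : Pred M n} {N′ : Pred M n′} (N? : Decidable N) (N′? : Decidable N′) →
             (∀ {a} → N a → N′ a) → (∀ {a} → N′ a → N a) → ∀ z → ∑ es N? z ≈ ∑ es N′? z
    ∑-same N? N′? N⊆N′ N′⊆N = ∑-enumerate N? (Unique.filter⁺ N′? es!)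
      (λ Na → ∈.∈-filter⁺ N′? (complete _) (N⊆N′ Na))
      (λ a∈ → N′⊆N (proj₂ (∈.∈-filter⁻ N′? {xs = es} a∈)))

  ∑-cong : ∀ {m n} {M : Set m} {N : Pred M n} (es : List M) (N? : Decidable N)
           {y z : M → Carrier} →
           (∀ e → y e ≈ z e) → ∑ es N? y ≈ ∑ es N? z
  ∑-cong es N? {y} {z} y≈z = go (filter N? es)
    where
    go : ∀ es → ∑-list es y ≈ ∑-list es z
    go []       = refl
    go (e ∷ es) = +-cong (y≈z e) (go es)

  ∑-list-++ : ∀ {m} {M : Set m} (es es′ : List M) (z : M → Carrier) →
              ∑-list (es ++ es′) z ≈ ∑-list es z + ∑-list es′ z
  ∑-list-++ []       es′ z = sym (+-identityˡ _)
  ∑-list-++ (e ∷ es) es′ z = trans (+-congˡ (∑-list-++ es es′ z))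
    (solve 3 (λ x y z → x :+ (y :+ z) := (x :+ y) :+ z) (refl) _ _ _)

-- Completeness and uniqueness of the lists of elements and arcs

module GraphProperties (p q : ℕ) .(q≤p : q ≤ p) where
  open Graph p q q≤p

  -- The shift by one avoids predecessors: `diagonalInto` of this element computes to the diagonal
  -- arc that leaves (i , j).
  element : ∀ i j → .(i < p) → .(j < suc i ⊓ q) → I
  element i j i<p j< = ⟨ suc i , suc j ⟩
    {s≤s z≤n} {ℕ.≤-trans j< (ℕ.m⊓n≤m _ _)} {i<p} {ℕ.≤-trans j< (ℕ.m⊓n≤n _ _)}

  record Element (e : I) : Set where
    constructor element-view
    field
      {i j} : ℕ
      i<p   : i < p
      j<    : j < suc i ⊓ q
      eq    : e ≡ element i j i<p j<

  -- The bounds stored in an element are irrelevant, but decidable, so they can be recomputed as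
  -- proofs to argue with.
  view : ∀ e → Element e
  view (⟨ suc i , suc j ⟩ {_} {c≤r} {r≤p} {c≤q}) =
    element-view (recompute (i <? p) r≤p) (recompute (j <? suc i ⊓ q) (ℕ.⊓-glb c≤r c≤q)) ≡.refl
  view (⟨ zero , suc j ⟩ {_} {()})
  view (⟨ r , zero ⟩ {()})

  private
    elements : ∀ (i : Fin p) → Fin (suc (toℕ i) ⊓ q) → I
    elements i j = element (toℕ i) (toℕ j) (toℕ<n i) (toℕ<n j)

  allI-unique : Unique allI
  allI-unique = enumeration-unique elements λ eq →
    toℕ-injective (ℕ.suc-injective (≡.cong row eq)) , ℕ.suc-injective (≡.cong col eq)

  allI-complete : ∀ e → e ∈ allI
  allI-complete e with element-view i<p j< ≡.refl ← view e
                  with i , ≡.refl ← fromℕ<-view i<p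
                  with j , ≡.refl ← fromℕ<-view j< = ∈-enumeration elements i j

  private
    -- Serves to read indices off an equation between arcs. The row of a sink arc and both values at
    -- `source` are placeholders.
    coordinates : Arc → ℕ × ℕ
    coordinates (vertical i j _ _) = i , j
    coordinates (diagonal i j _ _) = i , j
    coordinates source             = 0 , 0
    coordinates (sink j _)         = 0 , j

    verticals : ∀ (i : Fin p) → Fin (suc (toℕ i ⊓ q)) → Arc
    verticals i j = vertical (toℕ i) (toℕ j) (toℕ<n i) (toℕ≤pred[n] j)

    diagonals : ∀ (i : Fin p) → Fin (suc (toℕ i) ⊓ q) → Arc
    diagonals i j = diagonal (toℕ i) (toℕ j) (toℕ<n i) (toℕ<n j)

    sinks : Fin (suc q) → Arc
    sinks j = sink (toℕ j) (toℕ≤pred[n] j)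

  allArcs-unique : Unique allArcs
  allArcs-unique = Unique.++⁺
    (enumeration-unique verticals λ eq →
      toℕ-injective (≡.cong (proj₁ ∘ coordinates) eq) , ≡.cong (proj₂ ∘ coordinates) eq)
    (Unique.++⁺
      (enumeration-unique diagonals λ eq →
        toℕ-injective (≡.cong (proj₁ ∘ coordinates) eq) , ≡.cong (proj₂ ∘ coordinates) eq)
      (All.map⁺ (All.tabulate λ _ ()) ∷
       Unique.map⁺ (toℕ-injective ∘ ≡.cong (proj₂ ∘ coordinates)) (Unique.allFin⁺ (suc q)))
      diagonal∉)
    vertical∉
    where
    diagonal∉ : ∀ {a} → ¬ (a ∈ enumeration diagonals × a ∈ source ∷ map sinks (allFin (suc q)))
    diagonal∉ (a∈ , here ≡.refl) with _ , _ , () ← ∈-enumeration⁻ diagonals a∈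
    diagonal∉ (a∈ , there a∈′) with _ , _ , ≡.refl ← ∈-enumeration⁻ diagonals a∈
                               with _ , _ , () ← ∈.∈-map⁻ sinks a∈′
    vertical∉ : ∀ {a} → ¬ (a ∈ enumeration verticals ×
                           a ∈ enumeration diagonals ++ source ∷ map sinks (allFin (suc q)))
    vertical∉ (a∈ , a∈′) with _ , _ , ≡.refl ← ∈-enumeration⁻ verticals a∈
                         with ∈.∈-++⁻ (enumeration diagonals) a∈′
    ... | inj₁ a∈″ with _ , _ , () ← ∈-enumeration⁻ diagonals a∈″
    ... | inj₂ (there a∈″) with _ , _ , () ← ∈.∈-map⁻ sinks a∈″

  allArcs-complete : ∀ a → a ∈ allArcs
  allArcs-complete (vertical i j i<p j≤)
    with i , ≡.refl ← fromℕ<-view (recompute (i <? p) i<p)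
    with j , ≡.refl ← fromℕ<-view (s≤s (recompute (j ≤? toℕ i ⊓ q) j≤)) =
    ∈.∈-++⁺ˡ (∈-enumeration verticals i j)
  allArcs-complete (diagonal i j i<p j<)
    with i , ≡.refl ← fromℕ<-view (recompute (i <? p) i<p)
    with j , ≡.refl ← fromℕ<-view (recompute (j <? suc (toℕ i) ⊓ q) j<) =
    ∈.∈-++⁺ʳ (enumeration verticals) (∈.∈-++⁺ˡ (∈-enumeration diagonals i j))
  allArcs-complete source =
    ∈.∈-++⁺ʳ (enumeration verticals) (∈.∈-++⁺ʳ (enumeration diagonals) (here ≡.refl))
  allArcs-complete (sink j j≤q)
    with j , ≡.refl ← fromℕ<-view (s≤s (recompute (j ≤? q) j≤q)) =
    ∈.∈-++⁺ʳ (enumeration verticals) (∈.∈-++⁺ʳ (enumeration diagonals)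
      (there (∈.∈-map⁺ sinks (∈.∈-allFin j))))

module _ {a b} {A : Set a} {B : Set b} where

  -- Models an arc that exists only within certain bounds. With an empty list outside of them, the
  -- balance at a node on the boundary of the grid looks the same as in the interior.
  optional : Dec A → (.A → B) → List B
  optional (yes x) f = f x ∷ []
  optional (no  _) f = []

  optional-unique : ∀ (x? : Dec A) (f : .A → B) → Unique (optional x? f)
  optional-unique (yes _) f = [] ∷ []
  optional-unique (no  _) f = []

  ∈-optional : ∀ (x? : Dec A) (f : .A → B) .(x : A) → f x ∈ optional x? f
  ∈-optional (yes _) f x = here ≡.refl
  ∈-optional (no ¬x) f x = contradiction (recompute (no ¬x) x) ¬x

  ∈-optional⁻ : ∀ (x? : Dec A) (f : .A → B) {e} → e ∈ optional x? f → ∃ λ x → e ≡ f x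
  ∈-optional⁻ (yes x) f (here e≡fx) = x , e≡fx

-- Inflows of columns and sums over bars

module Tables {c ℓ₁ ℓ₂} (K : OrderedField c ℓ₁ ℓ₂) (p q : ℕ) .(q≤p : q ≤ p) where
  open OrderedField K
  open OrderedFieldProperties K
  open Polyhedra K
  open Sums K
  open Graph p q q≤p
  open GraphProperties p q q≤p
  open Polytope K p q q≤p

  -- The condition is on the tail (k , l), so k < i says that the head, in column j + 1, lies in one
  -- of the rows up to i.
  DiagonalTo : ℕ → ℕ → Pred Arc _
  DiagonalTo i j (diagonal k l _ _) = l ≡ j × k < i
  DiagonalTo i j _                  = ⊥

  diagonalTo? : ∀ i j → Decidable (DiagonalTo i j)
  diagonalTo? i j (vertical _ _ _ _) = no λ ()
  diagonalTo? i j (diagonal k l _ _) = (l ℕ.≟ j) ×-dec (k <? i)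
  diagonalTo? i j source             = no λ ()
  diagonalTo? i j (sink _ _)         = no λ ()

  -- Column 0 is entered through the source only, with one unit of flow.
  columnInflow : (Arc → Carrier) → ℕ → ℕ → Carrier
  columnInflow y i zero    = 1#
  columnInflow y i (suc j) = ∑ allArcs (diagonalTo? i j) y

  barFrom? : ∀ i j → Decidable (λ f → row f ≡ suc i × suc j ≤ col f)
  barFrom? i j f = (row f ℕ.≟ suc i) ×-dec (suc j ≤? col f)

  -- Indices are shifted by one: barSum x i j belongs to the element (i + 1 , j + 1).
  barSum : (I → Carrier) → ℕ → ℕ → Carrier
  barSum x i j = ∑ allI (barFrom? i j) x

  columnInflow-cong : ∀ {y y′} → (∀ a → y a ≈ y′ a) →
                      ∀ i j → columnInflow y i j ≈ columnInflow y′ i j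
  columnInflow-cong y≈y′ i zero    = refl
  columnInflow-cong y≈y′ i (suc j) = ∑-cong allArcs (diagonalTo? i j) y≈y′

  barSum-cong : ∀ {x x′} → (∀ e → x e ≈ x′ e) → ∀ i j → barSum x i j ≈ barSum x′ i j
  barSum-cong x≈x′ i j = ∑-cong allI (barFrom? i j) x≈x′

  Arc-∑-enumerate = ∑-enumerate allArcs-unique allArcs-complete

  verticals↓ diagonals↘ : ∀ i j → .(i < p) → List Arc
  verticals↓ i j i<p = optional (j ≤? i ⊓ q) (λ j≤ → vertical i j i<p j≤)
  diagonals↘ i j i<p = optional (j <? suc i ⊓ q) (λ j< → diagonal i j i<p j<)

  module _ (y : Arc → Carrier) where

    -- The head of a diagonal arc is a node of the grid; an arc counted here would have its head in
    -- column j and in a row up to i, which forces j ≤ i ⊓ q.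
    columnInflow-out : ∀ i j → ¬ (j ≤ i ⊓ q) → columnInflow y i j ≈ 0#
    columnInflow-out i zero    j≰ = contradiction z≤n j≰
    columnInflow-out i (suc j) j≰ = Arc-∑-enumerate (diagonalTo? i j) []
      (λ {e} → empty e) (λ ()) y
      where
      empty : ∀ a → DiagonalTo i j a → a ∈ []
      empty (diagonal k l _ l<) (≡.refl , k<i) = contradiction
        (ℕ.≤-trans (recompute (l <? suc k ⊓ q) l<) (ℕ.⊓-monoˡ-≤ q k<i)) j≰

    -- One more row adds a single diagonal arc, if it exists; otherwise both inflows vanish.
    columnInflow-suc : ∀ {i} j .(i<p : i < p) →
      columnInflow y (suc i) (suc j) ≈ ∑-list (diagonals↘ i j i<p) y + columnInflow y i (suc j)
    columnInflow-suc {i} j i<p with j <? suc i ⊓ q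
    ... | yes j< = trans
      (∑-insert allArcs-unique allArcs-complete (diagonalTo? (suc i) j) (diagonalTo? i j)
        (diagonal i j i<p j<) (λ (_ , i<i) → ℕ.<-irrefl ≡.refl i<i) (≡.refl , ℕ.n<1+n i)
        (λ {a} → weaken a) (λ {a} → split a) y)
      (+-congʳ (sym (+-identityʳ _)))
      where
      weaken : ∀ a → DiagonalTo i j a → DiagonalTo (suc i) j a
      weaken (diagonal k l _ _) (l≡j , k<i) = l≡j , ℕ.m<n⇒m<1+n k<i
      split : ∀ a → DiagonalTo (suc i) j a → a ≡ diagonal i j i<p j< ⊎ DiagonalTo i j a
      split (diagonal k l _ _) (≡.refl , k<1+i) with ℕ.m<1+n⇒m<n∨m≡n k<1+i
      ... | inj₁ k<i    = inj₂ (≡.refl , k<i)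
      ... | inj₂ ≡.refl = inj₁ ≡.refl
    ... | no j≮ = trans (columnInflow-out (suc i) (suc j) j≮)
      (sym (trans (+-identityˡ _) (columnInflow-out i (suc j)
        (λ j< → j≮ (ℕ.≤-trans j< (ℕ.⊓-monoˡ-≤ q (ℕ.n≤1+n i)))))))

    -- The tail of a diagonal arc is never in the column of its head, and no head lies above the
    -- first node of its column. Of the conditions in `In↘`, this leaves the column and the lower
    -- end of the range of rows.
    columnInflow-in↘ : ∀ i j .(i<p : i < p) .(j< : j < suc i ⊓ q) →
      ∑ allArcs (in↘? (col? (element i j i<p j<))) y ≈ columnInflow y (suc i) (suc j)
    columnInflow-in↘ i j i<p j< = ∑-same allArcs-unique allArcs-complete
      (in↘? (col? (element i j i<p j<))) (diagonalTo? (suc i) j) (λ {a} → to a) (λ {a} → from a) y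
      where
      to : ∀ a → In↘ (Col (element i j i<p j<)) a → DiagonalTo (suc i) j a
      to (diagonal k l _ _) (_ , (≡.refl , _ , k<) , _) = ≡.refl , k<
      from : ∀ a → DiagonalTo (suc i) j a → In↘ (Col (element i j i<p j<)) a
      from (diagonal k l _ l<) (≡.refl , k<) =
        tt , (≡.refl , ℕ.≤-trans (recompute (l <? suc k ⊓ q) l<) (ℕ.m⊓n≤m _ _) , k<) , λ ()

    outflow-s : ∑ allArcs (hasTail? s) y ≈ y source
    outflow-s = trans
      (Arc-∑-enumerate (hasTail? s) {source ∷ []} ([] ∷ [])
        (λ {a} → to a) (λ { (here ≡.refl) → ≡.refl }) y)
      (+-identityʳ _)
      where
      to : ∀ a → tail a ≡ s → a ∈ source ∷ []
      to source _ = here ≡.refl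

    inflow-origin : ∑ allArcs (hasHead? (grid 0 0 z≤n z≤n)) y ≈ y source
    inflow-origin = trans
      (Arc-∑-enumerate (hasHead? _) {source ∷ []} ([] ∷ [])
        (λ {a} → to a) (λ { (here ≡.refl) → ≡.refl }) y)
      (+-identityʳ _)
      where
      to : ∀ a → head a ≡ grid 0 0 z≤n z≤n → a ∈ source ∷ []
      to source _ = here ≡.refl

    inflow-left : ∀ {i} .(i<p : i < p) .(j≤ : 0 ≤ suc i ⊓ q) →
      ∑ allArcs (hasHead? (grid (suc i) 0 i<p j≤)) y ≈ ∑-list (verticals↓ i 0 i<p) y
    inflow-left {i} i<p j≤ = Arc-∑-enumerate (hasHead? _) ([] ∷ []) (λ {a} → to a)
      (λ { (here ≡.refl) → ≡.refl }) y
      where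
      to : ∀ a → head a ≡ grid (suc i) 0 i<p j≤ → a ∈ verticals↓ i 0 i<p
      to (vertical _ _ _ _) ≡.refl = here ≡.refl

    private
      disjoint : ∀ {i j k l} .(i<p : i < p) .(k<p : k < p) {a} →
        ¬ (a ∈ verticals↓ i j i<p × a ∈ diagonals↘ k l k<p)
      disjoint {i} {j} {k} {l} i<p k<p (a∈ , a∈′)
        with _ , ≡.refl ← ∈-optional⁻ (j ≤? i ⊓ q) _ a∈
        with _ , () ← ∈-optional⁻ (l <? suc k ⊓ q) _ a∈′

      unique : ∀ {i j k l} .(i<p : i < p) .(k<p : k < p) →
               Unique (verticals↓ i j i<p ++ diagonals↘ k l k<p)
      unique {i} {j} {k} {l} i<p k<p = Unique.++⁺ (optional-unique (j ≤? i ⊓ q) _)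
        (optional-unique (l <? suc k ⊓ q) _) (disjoint {i} {j} {k} {l} i<p k<p)

    inflow-inner : ∀ {i j} .(i<p : i < p) .(j≤ : suc j ≤ suc i ⊓ q) →
      ∑ allArcs (hasHead? (grid (suc i) (suc j) i<p j≤)) y ≈
      ∑-list (verticals↓ i (suc j) i<p) y + ∑-list (diagonals↘ i j i<p) y
    inflow-inner {i} {j} i<p j≤ = trans
      (Arc-∑-enumerate (hasHead? _) (unique {i} {suc j} {i} {j} i<p i<p) (λ {a} → to a) from y)
      (∑-list-++ (verticals↓ i (suc j) i<p) (diagonals↘ i j i<p) y)
      where
      to : ∀ a → head a ≡ grid (suc i) (suc j) i<p j≤ →
           a ∈ verticals↓ i (suc j) i<p ++ diagonals↘ i j i<p
      to (vertical _ _ _ j≤) ≡.refl = ∈.∈-++⁺ˡ (∈-optional (suc j ≤? i ⊓ q) _ j≤)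
      to (diagonal _ _ _ j<) ≡.refl =
        ∈.∈-++⁺ʳ (verticals↓ i (suc j) i<p) (∈-optional (j <? suc i ⊓ q) _ j<)
      from : ∀ {a} → a ∈ verticals↓ i (suc j) i<p ++ diagonals↘ i j i<p →
             head a ≡ grid (suc i) (suc j) i<p j≤
      from a∈ with ∈.∈-++⁻ (verticals↓ i (suc j) i<p) a∈
      ... | inj₁ a∈↓ with _ , ≡.refl ← ∈-optional⁻ (suc j ≤? i ⊓ q) _ a∈↓ = ≡.refl
      ... | inj₂ a∈↘ with _ , ≡.refl ← ∈-optional⁻ (j <? suc i ⊓ q) _ a∈↘ = ≡.refl

    outflow : ∀ {i j} (i<p : i < p) .(i≤p : i ≤ p) .(j≤ : j ≤ i ⊓ q) →
      ∑ allArcs (hasTail? (grid i j i≤p j≤)) y ≈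
      ∑-list (verticals↓ i j i<p) y + ∑-list (diagonals↘ i j i<p) y
    outflow {i} {j} i<p i≤p j≤ = trans
      (Arc-∑-enumerate (hasTail? _) (unique {i} {j} {i} {j} i<p i<p) (λ {a} → to a i<p) from y)
      (∑-list-++ (verticals↓ i j i<p) (diagonals↘ i j i<p) y)
      where
      to : ∀ a (i<p : i < p) → tail a ≡ grid i j i≤p j≤ →
           a ∈ verticals↓ i j i<p ++ diagonals↘ i j i<p
      to (vertical _ _ _ j≤) i<p ≡.refl = ∈.∈-++⁺ˡ (∈-optional (j ≤? i ⊓ q) _ j≤)
      to (diagonal _ _ _ j<) i<p ≡.refl =
        ∈.∈-++⁺ʳ (verticals↓ i j i<p) (∈-optional (j <? suc i ⊓ q) _ j<)
      -- Sink arcs leave row p only, and the match identifies i with p.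
      to (sink _ _) p<p ≡.refl = contradiction ≡.refl (ℕ.<⇒≢ p<p)
      from : ∀ {a} → a ∈ verticals↓ i j i<p ++ diagonals↘ i j i<p → tail a ≡ grid i j i≤p j≤
      from a∈ with ∈.∈-++⁻ (verticals↓ i j i<p) a∈
      ... | inj₁ a∈↓ with _ , ≡.refl ← ∈-optional⁻ (j ≤? i ⊓ q) _ a∈↓ = ≡.refl
      ... | inj₂ a∈↘ with _ , ≡.refl ← ∈-optional⁻ (j <? suc i ⊓ q) _ a∈↘ = ≡.refl

    outflow-bottom : ∀ {j} .(p≤p : p ≤ p) .(j≤ : j ≤ p ⊓ q) .(j≤q : j ≤ q) →
      ∑ allArcs (hasTail? (grid p j p≤p j≤)) y ≈ y (sink j j≤q)
    outflow-bottom {j} p≤p j≤ j≤q = trans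
      (Arc-∑-enumerate (hasTail? _) {sink j j≤q ∷ []} ([] ∷ [])
        (λ {a} → to a ≡.refl) (λ { (here ≡.refl) → ≡.refl }) y)
      (+-identityʳ _)
      where
      -- The row is a variable, as the parameter p cannot be unified with it.
      to : ∀ {i} a .{i≤p : i ≤ p} .{j≤ : j ≤ i ⊓ q} → i ≡ p →
           tail a ≡ grid i j i≤p j≤ → a ∈ sink j j≤q ∷ []
      to (vertical i _ i<p _) i≡p ≡.refl = contradiction i≡p (ℕ.<⇒≢ (recompute (i <? p) i<p))
      to (diagonal i _ i<p _) i≡p ≡.refl = contradiction i≡p (ℕ.<⇒≢ (recompute (i <? p) i<p))
      to (sink _ _)           i≡p ≡.refl = here ≡.refl

  module _ (x : I → Carrier) where

    barSum-out : ∀ i j → ¬ (j < suc i ⊓ q) → barSum x i j ≈ 0#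
    barSum-out i j j≮ = ∑-enumerate allI-unique allI-complete (barFrom? i j) []
      (λ {e} → empty e) (λ ()) x
      where
      empty : ∀ e → row e ≡ suc i × suc j ≤ col e → e ∈ []
      empty e (r , j<) with element-view i<p j′< ≡.refl ← view e with ≡.refl ← r =
        contradiction (ℕ.≤-trans j< j′<) j≮

    barSum-step : ∀ i j .(i<p : i < p) .(j< : j < suc i ⊓ q) →
      barSum x i j ≈ x (element i j i<p j<) + barSum x i (suc j)
    barSum-step i j i<p j< = ∑-insert allI-unique allI-complete
      (barFrom? i j) (barFrom? i (suc j)) (element i j i<p j<)
      (λ (_ , j<j) → ℕ.<-irrefl ≡.refl j<j) (≡.refl , ℕ.≤-refl)
      (λ (r , j<) → r , ℕ.<⇒≤ j<) (λ {e} → split e) x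
      where
      split : ∀ e → row e ≡ suc i × suc j ≤ col e →
              e ≡ element i j i<p j< ⊎ (row e ≡ suc i × suc (suc j) ≤ col e)
      split e (r , j<) with ℕ.m≤n⇒m<n∨m≡n j<
      ... | inj₁ j<′ = inj₂ (r , j<′)
      ... | inj₂ j≡
        with element-view _ _ ≡.refl ← view e
        with ≡.refl ← r
        with ≡.refl ← j≡ = inj₁ ≡.refl

-- Points of the polytope as tables of potentials and bar sums

module FeasibleTables {c ℓ₁ ℓ₂} (K : OrderedField c ℓ₁ ℓ₂) (p q : ℕ) (q≤p : q ≤ p) where
  open OrderedField K
  open OrderedFieldProperties K
  open Polyhedra K
  open Sums K
  open Graph p q q≤p
  open GraphProperties p q q≤p
  open Polytope K p q q≤p
  open Tables K p q q≤p
  open import Relation.Binary.Reasoning.Setoid setoid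

  -- `u-left` encodes flow value one and the last two fields nonnegativity; conservation is
  -- automatic for a flow made of differences. The inequalities may range over all j because u
  -- vanishes outside the grid.
  record Potential (u : ℕ → ℕ → Carrier) : Set (ℓ₁ ⊔ ℓ₂) where
    field
      u-left     : ∀ i → u i 0 ≈ 1#
      u-out      : ∀ i j → ¬ (j ≤ i ⊓ q) → u i j ≈ 0#
      u-vertical : ∀ {i} j → i < p → Nonneg (u i j - u (suc i) (suc j))
      u-diagonal : ∀ {i} j → i < p → Nonneg (u (suc i) (suc j) - u i (suc j))

  -- `v-bar` is inequality (b) and `v-diagonal` inequality (a) for the element (i + 1 , j + 1),
  -- whose bar sum is `v i j`.
  record Feasible (u v : ℕ → ℕ → Carrier) : Set (ℓ₁ ⊔ ℓ₂) where
    field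
      potential  : Potential u
      v-out      : ∀ {i} j → i < p → ¬ (j < suc i ⊓ q) → v i j ≈ 0#
      v-bar      : ∀ {i} j → i < p → Nonneg (u (suc i) (suc j) - v i j)
      v-diagonal : ∀ {i} j → i < p →
                   Nonneg ((v i j - v i (suc j)) - (u (suc i) (suc j) - u i (suc j)))
    open Potential potential public

  -- As bar sums are indexed with a shift by one, `col e` is the index of the bar that starts just
  -- right of `e`. A sink arc carries what has entered column j and has not left it for column j +
  -- 1.
  point : (u v : ℕ → ℕ → Carrier) → I ⊎ Arc → Carrier
  point u v (inj₁ e)                  = v (pred (row e)) (pred (col e)) - v (pred (row e)) (col e)
  point u v (inj₂ (vertical i j _ _)) = u i j - u (suc i) (suc j)
  point u v (inj₂ (diagonal i j _ _)) = u (suc i) (suc j) - u i (suc j)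
  point u v (inj₂ source)             = 1#
  point u v (inj₂ (sink j _))         = u p j - u p (suc j)

  ≰⊓-suc : ∀ {i j} → ¬ (j ≤ i ⊓ q) → ¬ (suc j ≤ suc i ⊓ q)
  ≰⊓-suc j≰ j< = j≰ (ℕ.⊓-glb
    (ℕ.s≤s⁻¹ (ℕ.≤-trans j< (ℕ.m⊓n≤m _ _)))
    (ℕ.<⇒≤ (ℕ.≤-trans j< (ℕ.m⊓n≤n _ _))))

  ≰⊓-down : ∀ {i j} → ¬ (j ≤ suc i ⊓ q) → ¬ (j ≤ i ⊓ q)
  ≰⊓-down j≰ j≤ = j≰ (ℕ.≤-trans j≤ (ℕ.⊓-monoˡ-≤ q (ℕ.n≤1+n _)))

  ≰-suc : ∀ {i j} → ¬ (j ≤ i) → ¬ (suc j ≤ i)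
  ≰-suc j≰ j< = j≰ (ℕ.<⇒≤ j<)

  -- From points to tables

  module FromPoint {z : I ⊎ Arc → Carrier} (z∈P : P z) where
    open P z∈P
    open F flow

    u v : ℕ → ℕ → Carrier
    u = columnInflow y
    v = barSum x

    y↓ y↘ : ∀ i j → .(i < p) → Carrier
    y↓ i j i<p = ∑-list (verticals↓ i j i<p) y
    y↘ i j i<p = ∑-list (diagonals↘ i j i<p) y

    ∑-list-nonneg : ∀ es → Nonneg (∑-list es y)
    ∑-list-nonneg []       = 0-nonneg
    ∑-list-nonneg (e ∷ es) = +-nonneg (nonnegative e) (∑-list-nonneg es)

    source-unit : y source ≈ 1#
    source-unit = trans (sym (outflow-s y)) unit

    y↘-potential : ∀ {i} j .(i<p : i < p) → y↘ i j i<p ≈ u (suc i) (suc j) - u i (suc j)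
    y↘-potential {i} j i<p = trans (solve 2 (λ d u → d := (d :+ u) :- u) refl _ (u i (suc j)))
      (+-congʳ (sym (columnInflow-suc y j i<p)))

    -- What arrives at (i , j) is what has entered column j in the rows up to i, minus what has left
    -- it for column j + 1 from the rows before i.
    inflow : ℕ → ℕ → Set _
    inflow i j = .(i≤p : i ≤ p) .(j≤ : j ≤ i ⊓ q) →
      ∑ allArcs (hasHead? (grid i j i≤p j≤)) y ≈ u i j - u i (suc j)

    -- By conservation, the vertical flow is the inflow of the node minus its diagonal outflow.
    -- Outside the grid there is no arc, and both values of u vanish.
    y↓-potential : ∀ {i} j (i<p : i < p) → inflow i j → y↓ i j i<p ≈ u i j - u (suc i) (suc j)
    y↓-potential {i} j i<p in≈ = by-cases (j ≤? i ⊓ q)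
      where
      by-cases : Dec (j ≤ i ⊓ q) → y↓ i j i<p ≈ u i j - u (suc i) (suc j)
      by-cases (yes j≤) = begin
        y↓ i j i<p
          ≈⟨ solve 2 (λ v d → v := (v :+ d) :- d) refl _ _ ⟩
        (y↓ i j i<p + y↘ i j i<p) - y↘ i j i<p
          ≈⟨ +-cong (sym (outflow y i<p (ℕ.<⇒≤ i<p) j≤)) (-‿cong (y↘-potential j i<p)) ⟩
        ∑ allArcs (hasTail? (grid i j _ j≤)) y - (u (suc i) (suc j) - u i (suc j))
          ≈⟨ +-congʳ (conservation (grid i j _ j≤) (λ ()) (λ ())) ⟨
        ∑ allArcs (hasHead? (grid i j _ j≤)) y - (u (suc i) (suc j) - u i (suc j))
          ≈⟨ +-congʳ (in≈ (ℕ.<⇒≤ i<p) j≤) ⟩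
        (u i j - u i (suc j)) - (u (suc i) (suc j) - u i (suc j))
          ≈⟨ solve 3 (λ a b c → (a :- b) :- (c :- b) := a :- c) refl _ _ _ ⟩
        u i j - u (suc i) (suc j) ∎
      by-cases (no j≰) = trans (vanishes (j ≤? i ⊓ q))
        (sym (difference-≈0 (columnInflow-out y i j j≰)
          (columnInflow-out y (suc i) (suc j) (≰⊓-suc j≰))))
        where
        vanishes : ∀ d → ∑-list (optional d (λ j≤ → vertical i j i<p j≤)) y ≈ 0#
        vanishes (yes j≤) = contradiction j≤ j≰
        vanishes (no  _)  = refl

    -- Induction on the row: the vertical flow into a node is known from conservation one row above,
    -- the diagonal flow from the definition of u. The origin receives the unit from the source.
    inflow-potential : ∀ i j → i ≤ p → inflow i j
    inflow-potential zero    (suc j) _   _ j≤ with () ← recompute (suc j ≤? 0 ⊓ q) j≤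
    inflow-potential zero    zero    _   _ _  = trans (inflow-origin y) (trans source-unit
      (sym (difference-≈1 refl (columnInflow-out y 0 1 λ ()))))
    inflow-potential (suc i) zero    i<p _ j≤ = begin
      _                                       ≈⟨ inflow-left y i<p j≤ ⟩
      y↓ i 0 i<p
        ≈⟨ y↓-potential 0 i<p (inflow-potential i 0 (ℕ.<⇒≤ i<p)) ⟩
      1# - u (suc i) 1                        ∎
    inflow-potential (suc i) (suc j) i<p _ j≤ = begin
      _                                       ≈⟨ inflow-inner y i<p j≤ ⟩
      y↓ i (suc j) i<p + y↘ i j i<p
        ≈⟨ +-cong (y↓-potential (suc j) i<p (inflow-potential i (suc j) (ℕ.<⇒≤ i<p)))
                  (y↘-potential j i<p) ⟩
      (u i (suc j) - u (suc i) (suc (suc j))) + (u (suc i) (suc j) - u i (suc j))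
        ≈⟨ solve 3 (λ a b c → (a :- b) :+ (c :- a) := c :- b) refl _ _ _ ⟩
      u (suc i) (suc j) - u (suc i) (suc (suc j)) ∎

    vertical≈ : ∀ {i} j (i<p : i < p) → y↓ i j i<p ≈ u i j - u (suc i) (suc j)
    vertical≈ j i<p = y↓-potential j i<p (inflow-potential _ j (ℕ.<⇒≤ i<p))

    ∑-optional : ∀ {a} {A : Set a} (d : Dec A) (f : .A → Arc) .(x : A) →
                 ∑-list (optional d f) y ≈ y (f x)
    ∑-optional (yes _) f x = +-identityʳ _
    ∑-optional (no ¬x) f x = contradiction (recompute (no ¬x) x) ¬x

    x≈ : ∀ i j .(i<p : i < p) .(j< : j < suc i ⊓ q) →
         x (element i j i<p j<) ≈ v i j - v i (suc j)
    x≈ i j i<p j< = trans (solve 2 (λ a b → a := (a :+ b) :- b) refl _ _)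
      (+-congʳ (sym (barSum-step x i j i<p j<)))

    diagonal≈ : ∀ i j .(i<p : i < p) .(j< : j < suc i ⊓ q) →
                y (diagonal i j i<p j<) ≈ u (suc i) (suc j) - u i (suc j)
    diagonal≈ i j i<p j< = trans
      (sym (∑-optional (j <? suc i ⊓ q) (λ j< → diagonal i j i<p j<) j<))
      (y↘-potential j i<p)

    feasible : Feasible u v
    feasible = record
      { potential  = record
        { u-left     = λ i → refl
        ; u-out      = columnInflow-out y
        ; u-vertical = λ j i<p → Nonneg-resp (vertical≈ j i<p)
            (∑-list-nonneg (verticals↓ _ j i<p))
        ; u-diagonal = λ j i<p → Nonneg-resp (y↘-potential j i<p)
            (∑-list-nonneg (diagonals↘ _ j i<p))
        }
      ; v-out      = λ {i} j _ → barSum-out x i j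
      ; v-bar      = λ {i} j i<p → bar i j i<p (j <? suc i ⊓ q)
      ; v-diagonal = λ {i} j i<p → diag i j i<p (j <? suc i ⊓ q)
      }
      where
      bar : ∀ i j → i < p → Dec (j < suc i ⊓ q) → Nonneg (u (suc i) (suc j) - v i j)
      bar i j i<p (yes j<) = ≤⇒nonneg (≤-respʳ-≈ (columnInflow-in↘ y i j i<p j<)
        (boundᵇ (element i j i<p j<)))
      bar i j i<p (no  j≮) = ≈0⇒nonneg
        (difference-≈0 (columnInflow-out y (suc i) (suc j) j≮) (barSum-out x i j j≮))
      diag : ∀ i j → i < p → Dec (j < suc i ⊓ q) →
             Nonneg ((v i j - v i (suc j)) - (u (suc i) (suc j) - u i (suc j)))
      diag i j i<p (yes j<) = Nonneg-resp
        (+-cong (x≈ i j i<p j<) (-‿cong (diagonal≈ i j i<p j<)))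
        (≤⇒nonneg (boundᵃ (element i j i<p j<)))
      diag i j i<p (no  j≮) = ≈0⇒nonneg (difference-≈0
        (difference-≈0 (barSum-out x i j j≮) (barSum-out x i (suc j) (≰-suc j≮)))
        (difference-≈0 (columnInflow-out y (suc i) (suc j) j≮)
          (columnInflow-out y i (suc j) (≰⊓-down j≮))))

    is-point : ∀ e → z e ≈ point u v e
    is-point (inj₁ e) with element-view {i} {j} i<p j< ≡.refl ← view e = x≈ i j i<p j<
    is-point (inj₂ (vertical i j i<p j≤)) = trans
      (sym (∑-optional (j ≤? i ⊓ q) (λ j≤ → vertical i j i<p j≤) j≤))
      (vertical≈ j (recompute (i <? p) i<p))
    is-point (inj₂ (diagonal i j i<p j<)) = diagonal≈ i j i<p j<
    is-point (inj₂ source) = source-unit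
    is-point (inj₂ (sink j j≤q)) = trans (sym (outflow-bottom y ℕ.≤-refl j≤ j≤q)) (trans
      (sym (conservation (grid p j _ j≤) (λ ()) (λ ())))
      (inflow-potential p j ℕ.≤-refl ℕ.≤-refl j≤))
      where
      j≤ : j ≤ p ⊓ q
      j≤ = ℕ.⊓-glb (ℕ.≤-trans (recompute (j ≤? q) j≤q) q≤p) (recompute (j ≤? q) j≤q)

  -- From tables to points

  module ToPoint {u v : ℕ → ℕ → Carrier} (feas : Feasible u v) where
    open Feasible feas

    x : I → Carrier
    x = point u v ∘ inj₁
    y : Arc → Carrier
    y = point u v ∘ inj₂

    y↓≈ : ∀ i j .(i<p : i < p) → ∑-list (verticals↓ i j i<p) y ≈ u i j - u (suc i) (suc j)
    y↓≈ i j i<p with j ≤? i ⊓ q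
    ... | yes _  = +-identityʳ _
    ... | no j≰ = sym (difference-≈0 (u-out i j j≰) (u-out (suc i) (suc j) (≰⊓-suc j≰)))

    y↘≈ : ∀ i j .(i<p : i < p) → ∑-list (diagonals↘ i j i<p) y ≈ u (suc i) (suc j) - u i (suc j)
    y↘≈ i j i<p with j <? suc i ⊓ q
    ... | yes _  = +-identityʳ _
    ... | no j≰ = sym (difference-≈0 (u-out (suc i) (suc j) j≰) (u-out i (suc j) (≰⊓-down j≰)))

    -- Telescoping over the rows. Together with `barSum-point` this recovers the tables from the
    -- point, so that equal points have equal tables within the rows of the grid.
    columnInflow-point : ∀ {i} j → i ≤ p → columnInflow y i j ≈ u i j
    columnInflow-point {i}     zero    _   = sym (u-left i)
    columnInflow-point {zero}  (suc j) _   = trans (columnInflow-out y 0 (suc j) λ ())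
      (sym (u-out 0 (suc j) λ ()))
    columnInflow-point {suc i} (suc j) i<p = begin
      columnInflow y (suc i) (suc j)     ≈⟨ columnInflow-suc y j i<p ⟩
      ∑-list (diagonals↘ i j i<p) y + columnInflow y i (suc j)
        ≈⟨ +-cong (y↘≈ i j i<p) (columnInflow-point (suc j) (ℕ.<⇒≤ i<p)) ⟩
      (u (suc i) (suc j) - u i (suc j)) + u i (suc j)
        ≈⟨ solve 2 (λ a b → (a :- b) :+ b := a) refl _ _ ⟩
      u (suc i) (suc j) ∎

    barSum-point : ∀ {i} j → i < p → barSum x i j ≈ v i j
    barSum-point {i} j i<p = go q j (ℕ.m≤m+n q j)
      where
      -- Descending induction on j; n bounds the number of columns that remain to the right.
      go : ∀ n j → q ≤ n ℕ.+ j → barSum x i j ≈ v i j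
      go n j q≤n+j with j <? suc i ⊓ q
      go n       j q≤n+j | no j≮ = trans (barSum-out x i j j≮) (sym (v-out j i<p j≮))
      go zero    j q≤j   | yes j< = contradiction (ℕ.≤-trans j< (ℕ.m⊓n≤n _ _)) (ℕ.≤⇒≯ q≤j)
      go (suc n) j q≤n+j | yes j< = begin
        barSum x i j                            ≈⟨ barSum-step x i j i<p j< ⟩
        (v i j - v i (suc j)) + barSum x i (suc j)
          ≈⟨ +-congˡ (go n (suc j) (ℕ.≤-trans q≤n+j (ℕ.≤-reflexive (≡.sym (ℕ.+-suc n j))))) ⟩
        (v i j - v i (suc j)) + v i (suc j)     ≈⟨ solve 2 (λ a b → (a :- b) :+ b := a) refl _ _ ⟩
        v i j                                   ∎

    -- The difference is the inflow of (i , j), a sum of flows on a diagonal and a vertical arc. In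
    -- row p it is the flow on a sink arc.
    u-decreasing : ∀ i j → i ≤ p → Nonneg (u i j - u i (suc j))
    u-decreasing zero    zero    _   = Nonneg-resp
      (sym (difference-≈1 (u-left 0) (u-out 0 1 λ ()))) 1-nonneg
    u-decreasing zero    (suc j) _   = ≈0⇒nonneg
      (difference-≈0 (u-out 0 (suc j) λ ()) (u-out 0 (suc (suc j)) λ ()))
    u-decreasing (suc i) zero    i<p = Nonneg-resp
      (+-congʳ (trans (u-left i) (sym (u-left (suc i))))) (u-vertical 0 i<p)
    u-decreasing (suc i) (suc j) i<p = Nonneg-resp
      (solve 3 (λ a b c → (a :- b) :+ (b :- c) := a :- c) refl _ _ _)
      (+-nonneg (u-diagonal j i<p) (u-vertical (suc j) i<p))

    private
      y-nonneg : ∀ a → Nonneg (y a)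
      y-nonneg (vertical i j i<p _) = u-vertical j (recompute (i <? p) i<p)
      y-nonneg (diagonal i j i<p _) = u-diagonal j (recompute (i <? p) i<p)
      y-nonneg source               = 1-nonneg
      y-nonneg (sink j _)           = u-decreasing p j ℕ.≤-refl

      inflow≈ : ∀ i j .(i≤p : i ≤ p) .(j≤ : j ≤ i ⊓ q) →
        ∑ allArcs (hasHead? (grid i j i≤p j≤)) y ≈ u i j - u i (suc j)
      inflow≈ zero    (suc j) _   j≤ with () ← recompute (suc j ≤? 0 ⊓ q) j≤
      inflow≈ zero    zero    _   _  = trans (inflow-origin y)
        (sym (difference-≈1 (u-left 0) (u-out 0 1 λ ())))
      inflow≈ (suc i) zero    i<p j≤ = begin
        _                           ≈⟨ inflow-left y i<p j≤ ⟩
        _                           ≈⟨ y↓≈ i 0 i<p ⟩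
        u i 0 - u (suc i) 1         ≈⟨ +-congʳ (trans (u-left i) (sym (u-left (suc i)))) ⟩
        u (suc i) 0 - u (suc i) 1   ∎
      inflow≈ (suc i) (suc j) i<p j≤ = begin
        _                           ≈⟨ inflow-inner y i<p j≤ ⟩
        _                           ≈⟨ +-cong (y↓≈ i (suc j) i<p) (y↘≈ i j i<p) ⟩
        (u i (suc j) - u (suc i) (suc (suc j))) + (u (suc i) (suc j) - u i (suc j))
          ≈⟨ solve 3 (λ a b c → (a :- b) :+ (c :- a) := c :- b) refl _ _ _ ⟩
        u (suc i) (suc j) - u (suc i) (suc (suc j)) ∎

      outflow≈ : ∀ i j .(i≤p : i ≤ p) .(j≤ : j ≤ i ⊓ q) → Dec (i ≡ p) →
        ∑ allArcs (hasTail? (grid i j i≤p j≤)) y ≈ u i j - u i (suc j)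
      outflow≈ i j i≤p j≤ (yes ≡.refl) = outflow-bottom y i≤p j≤ (ℕ.≤-trans j≤ (ℕ.m⊓n≤n _ _))
      outflow≈ i j i≤p j≤ (no i≢p) = begin
        _                           ≈⟨ outflow y (ℕ.≤∧≢⇒< (recompute (i ≤? p) i≤p) i≢p) i≤p j≤ ⟩
        _                           ≈⟨ +-cong (y↓≈ i j _) (y↘≈ i j _) ⟩
        (u i j - u (suc i) (suc j)) + (u (suc i) (suc j) - u i (suc j))
          ≈⟨ solve 3 (λ a b c → (a :- b) :+ (b :- c) := a :- c) refl _ _ _ ⟩
        u i j - u i (suc j) ∎

    -- Conservation holds since the inflow and the outflow of (i , j) both telescope to u i j - u i
    -- (j + 1).
    point∈P : P (point u v)
    point∈P = record
      { flow = record
        { nonnegative  = y-nonneg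
        ; conservation = λ
          { (grid i j i≤p j≤) _ _ → trans (inflow≈ i j i≤p j≤)
              (sym (outflow≈ i j i≤p j≤ (i ℕ.≟ p)))
          ; s s≢s _ → contradiction ≡.refl s≢s
          ; t _ t≢t → contradiction ≡.refl t≢t }
        ; unit = outflow-s y
        }
      ; boundᵃ = λ e → bound-diagonal e (view e)
      ; boundᵇ = λ e → bound-bar e (view e)
      }
      where
      bound-diagonal : ∀ e → Element e → y (diagonalInto e) ≤ᶠ x e
      bound-diagonal _ (element-view {j = j} i<p j< ≡.refl) = nonneg⇒≤ (v-diagonal j i<p)
      bound-bar : ∀ e → Element e → ∑ allI (bar? e) x ≤ᶠ ∑ allArcs (in↘? (col? e)) y
      bound-bar _ (element-view {i} {j} i<p j< ≡.refl) = ≤-respˡ-≈ (sym (barSum-point j i<p))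
        (≤-respʳ-≈ (sym (trans (columnInflow-in↘ y i j i<p j<) (columnInflow-point (suc j) i<p)))
          (nonneg⇒≤ (v-bar j i<p)))

-- Vertices

module Integrality {c ℓ₁ ℓ₂} (K : OrderedField c ℓ₁ ℓ₂) (p q : ℕ) (q≤p : q ≤ p) where
  open OrderedField K
  open OrderedFieldProperties K
  open Polyhedra K
  open Graph p q q≤p
  open GraphProperties p q q≤p
  open Polytope K p q q≤p
  open Tables K p q q≤p
  open FeasibleTables K p q q≤p
  open import Relation.Binary.Reasoning.Setoid setoid

  -- Squares of potentials

  module Squares {u : ℕ → ℕ → Carrier} (pot : Potential u) where
    open Potential pot

    u-nonneg : ∀ {i} j → i ≤ p → Nonneg (u i j)
    u-nonneg {i}     zero    _   = Nonneg-resp (sym (u-left i)) 1-nonneg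
    u-nonneg {zero}  (suc j) _   = ≈0⇒nonneg (u-out 0 (suc j) λ ())
    u-nonneg {suc i} (suc j) i<p = Nonneg-resp (solve 2 (λ a b → (a :- b) :+ b := a) refl _ _)
      (+-nonneg (u-diagonal j i<p) (u-nonneg (suc j) (ℕ.<⇒≤ i<p)))

    -- By `u-vertical`, going from (i , j) to (i - 1 , j - 1) does not decrease u, and this ends in
    -- column 0 or row 0, where u is 1 or 0.
    u≤1 : ∀ {i} j → i ≤ p → Nonneg (1# - u i j)
    u≤1 {i}     zero    _   = ≈0⇒nonneg (trans (+-congˡ (-‿cong (u-left i))) (-‿inverseʳ 1#))
    u≤1 {zero}  (suc j) _   = Nonneg-resp
      (sym (difference-≈1 refl (u-out 0 (suc j) λ ()))) 1-nonneg
    u≤1 {suc i} (suc j) i<p = Nonneg-resp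
      (solve 2 (λ a b → (a :- b) :+ (:1 :- a) := :1 :- b) refl _ _)
      (+-nonneg (u-vertical j i<p) (u≤1 j (ℕ.<⇒≤ i<p)))

    square : Potential (λ i j → u i j * u i j)
    square = record
      { u-left     = λ i → trans (square-cong (u-left i)) 1²≈1
      ; u-out      = λ i j j≰ → trans (square-cong (u-out i j j≰)) 0²≈0
      ; u-vertical = λ j i<p → square-nonneg
          (u-nonneg j (ℕ.<⇒≤ i<p)) (u-nonneg (suc j) i<p) (u-vertical j i<p)
      ; u-diagonal = λ j i<p → square-nonneg
          (u-nonneg (suc j) i<p) (u-nonneg (suc j) (ℕ.<⇒≤ i<p)) (u-diagonal j i<p)
      }

    dual : Potential (λ i j → dual-square (u i j))
    dual = record
      { u-left     = λ i → trans (dual-square-cong (u-left i)) dual-square-1≈1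
      ; u-out      = λ i j j≰ → trans (dual-square-cong (u-out i j j≰)) dual-square-0≈0
      ; u-vertical = λ j i<p → dual-square-nonneg
          (u≤1 j (ℕ.<⇒≤ i<p)) (u≤1 (suc j) i<p) (u-vertical j i<p)
      ; u-diagonal = λ j i<p → dual-square-nonneg
          (u≤1 (suc j) i<p) (u≤1 (suc j) (ℕ.<⇒≤ i<p)) (u-diagonal j i<p)
      }

  -- y on the vertical arc that leaves (i , j + 1).
  drop : (ℕ → ℕ → Carrier) → ℕ → ℕ → Carrier
  drop u i j = u i (suc j) - u (suc i) (suc (suc j))

  -- Here s is the slack of (b). In terms of s, the value u (i + 1) (j + 1) cancels from (a), which
  -- becomes `s-drop`: a bound on the growth of s from right to left in a row.
  record Slack (u s : ℕ → ℕ → Carrier) : Set (ℓ₁ ⊔ ℓ₂) where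
    field
      s-out    : ∀ {i} j → i < p → ¬ (j < suc i ⊓ q) → s i j ≈ 0#
      s-nonneg : ∀ {i} j → i < p → Nonneg (s i j)
      s-drop   : ∀ {i} j → i < p → Nonneg (s i (suc j) + drop u i j - s i j)

  slack⇒feasible : ∀ {u s} → Potential u → Slack u s →
                   Feasible u (λ i j → u (suc i) (suc j) - s i j)
  slack⇒feasible pot sl = record
    { potential  = pot
    ; v-out      = λ {i} j i<p j≮ → difference-≈0 (u-out (suc i) (suc j) j≮) (s-out j i<p j≮)
    ; v-bar      = λ j i<p → Nonneg-resp
        (solve 2 (λ u s → s := u :- (u :- s)) refl _ _) (s-nonneg j i<p)
    ; v-diagonal = λ j i<p → Nonneg-resp
        (solve 5 (λ s s′ a b c → s′ :+ (c :- b) :- s :=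
                                 ((a :- s) :- (b :- s′)) :- (a :- c)) refl _ _ _ _ _)
        (s-drop j i<p)
    }
    where
    open Potential pot
    open Slack sl

  -- Splitting the slacks along with the potential

  module Split {u v a b} (feas : Feasible u v) (pot-a : Potential a) (pot-b : Potential b)
               (a+b≈2u : ∀ i j → a i j + b i j ≈ u i j + u i j) where
    open Feasible feas
    private
      module Potᵃ = Potential pot-a
      module Potᵇ = Potential pot-b

    slack : ℕ → ℕ → Carrier
    slack i j = u (suc i) (suc j) - v i j

    slack-out : ∀ {i} j → i < p → ¬ (j < suc i ⊓ q) → slack i j ≈ 0#
    slack-out {i} j i<p j≮ = difference-≈0 (u-out (suc i) (suc j) j≮) (v-out j i<p j≮)

    slack-drop : ∀ {i} j → i < p → Nonneg (slack i (suc j) + drop u i j - slack i j)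
    slack-drop {i} j i<p = Nonneg-resp
      (solve 5 (λ v v′ a b c → (v :- v′) :- (a :- c) :=
                               (b :- v′) :+ (c :- b) :- (a :- v)) refl _ _ _ _ _)
      (v-diagonal j i<p)

    -- From right to left, the share of `a` in the doubled slack is as large as `s-drop` for `a`
    -- permits, capped so that the share of `b` stays nonnegative. The first argument counts the
    -- remaining columns; the start value 0 is used from column index q on, where the slack
    -- vanishes.
    greedy : ℕ → ℕ → ℕ → Carrier
    greedy zero    i j = 0#
    greedy (suc n) i j = proj₁ (min (greedy n i (suc j) + drop a i j) (double (slack i j)))

    greedy-bounds : ∀ n {i} j → i < p →
                    Nonneg (greedy n i j) × Nonneg (double (slack i j) - greedy n i j)
    greedy-bounds zero {i} j i<p = 0-nonneg , Nonneg-resp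
      (solve 1 (λ x → x := x :- :0) refl _)
      (+-nonneg (v-bar j i<p) (v-bar j i<p))
    greedy-bounds (suc n) {i} j i<p
      with min (greedy n i (suc j) + drop a i j) (double (slack i j))
    ... | _ , _ , m≤ , inj₁ ≡.refl =
      +-nonneg (proj₁ (greedy-bounds n (suc j) i<p)) (Potᵃ.u-vertical (suc j) i<p) , ≤⇒nonneg m≤
    ... | _ , _ , m≤ , inj₂ ≡.refl = +-nonneg (v-bar j i<p) (v-bar j i<p) , ≤⇒nonneg m≤

    -- If the cap is attained, nothing is left for `b` at j and its inequality is a sum of
    -- nonnegative terms. If the bound for `a` is attained, the inequality for `b` is twice
    -- `slack-drop`, because the drops of `a` and `b` add up to twice the drop of `u`.
    greedy-step : ∀ n {i} j → i < p →
      Nonneg (greedy n i (suc j) + drop a i j - greedy (suc n) i j) ×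
      Nonneg ((double (slack i (suc j)) - greedy n i (suc j)) + drop b i j -
              (double (slack i j) - greedy (suc n) i j))
    greedy-step n {i} j i<p
      with min (greedy n i (suc j) + drop a i j) (double (slack i j))
    ... | _ , m≤ , _ , inj₂ ≡.refl = ≤⇒nonneg m≤ , Nonneg-resp
      (solve 2 (λ x y → x := x :- (y :- y)) refl _ _)
      (+-nonneg (proj₂ (greedy-bounds n (suc j) i<p)) (Potᵇ.u-vertical (suc j) i<p))
    ... | _ , m≤ , _ , inj₁ ≡.refl = ≤⇒nonneg m≤ , Nonneg-resp (begin
      double (slack i (suc j) + drop u i j - slack i j)
        ≈⟨ solve 4 (λ s s′ w w′ → (s′ :+ (w :- w′) :- s) :+ (s′ :+ (w :- w′) :- s) :=
             (s′ :+ s′) :+ ((w :+ w) :- (w′ :+ w′)) :- (s :+ s)) refl _ _ _ _ ⟩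
      double (slack i (suc j)) + (double (u i (suc j)) - double (u (suc i) (suc (suc j))))
        - double (slack i j)
        ≈⟨ +-congʳ (+-congˡ (+-cong (a+b≈2u i (suc j))
             (-‿cong (a+b≈2u (suc i) (suc (suc j)))))) ⟨
      double (slack i (suc j)) + ((a i (suc j) + b i (suc j)) -
        (a (suc i) (suc (suc j)) + b (suc i) (suc (suc j)))) - double (slack i j)
        ≈⟨ solve 7 (λ s s′ g a a′ b b′ → s′ :+ ((a :+ b) :- (a′ :+ b′)) :- s :=
             (s′ :- g) :+ (b :- b′) :- (s :- (g :+ (a :- a′))))
             refl _ _ (greedy n i (suc j)) _ _ _ _ ⟩
      _ ∎)
      (+-nonneg (slack-drop j i<p) (slack-drop j i<p))

    slackᵃ slackᵇ : ℕ → ℕ → Carrier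
    slackᵃ i j = greedy (q ℕ.∸ j) i j
    slackᵇ i j = double (slack i j) - slackᵃ i j

    double-slack-out : ∀ {i} j → i < p → ¬ (j < suc i ⊓ q) → double (slack i j) ≈ 0#
    double-slack-out j i<p j≮ =
      trans (+-cong (slack-out j i<p j≮) (slack-out j i<p j≮)) (+-identityʳ 0#)

    -- Squeezed between 0 and twice the slack, which vanishes there.
    slackᵃ-out : ∀ {i} j → i < p → ¬ (j < suc i ⊓ q) → slackᵃ i j ≈ 0#
    slackᵃ-out {i} j i<p j≮ with greedy-bounds (q ℕ.∸ j) j i<p
    ... | 0≤g , g≤2s = antisym (≤-respʳ-≈ (double-slack-out j i<p j≮) (nonneg⇒≤ g≤2s)) 0≤g

    slackᵇ-out : ∀ {i} j → i < p → ¬ (j < suc i ⊓ q) → slackᵇ i j ≈ 0#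
    slackᵇ-out j i<p j≮ = difference-≈0 (double-slack-out j i<p j≮) (slackᵃ-out j i<p j≮)

    ∸-step : ∀ {m n} → m < n → n ℕ.∸ m ≡ suc (n ℕ.∸ suc m)
    ∸-step (s≤s m≤n) = ℕ.+-∸-assoc 1 m≤n

    drops : ∀ {i} j → i < p →
      Nonneg (slackᵃ i (suc j) + drop a i j - slackᵃ i j) ×
      Nonneg (slackᵇ i (suc j) + drop b i j - slackᵇ i j)
    drops {i} j i<p with j <? suc i ⊓ q
    -- Neighbouring columns have consecutive step counts, as `greedy-step` requires.
    ... | yes j< rewrite ∸-step (ℕ.≤-trans j< (ℕ.m⊓n≤n (suc i) q)) =
      greedy-step (q ℕ.∸ suc j) j i<p
    ... | no j≮ =
      vanish (slackᵃ-out j i<p j≮) (slackᵃ-out (suc j) i<p (≰-suc j≮))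
        (Potᵃ.u-vertical (suc j) i<p) ,
      vanish (slackᵇ-out j i<p j≮) (slackᵇ-out (suc j) i<p (≰-suc j≮))
        (Potᵇ.u-vertical (suc j) i<p)
      where
      vanish : ∀ {s s′ d} → s ≈ 0# → s′ ≈ 0# → Nonneg d → Nonneg (s′ + d - s)
      vanish s≈0 s′≈0 = Nonneg-resp (sym (trans (+-cong (+-congʳ s′≈0) (-‿cong s≈0))
        (solve 1 (λ d → :0 :+ d :- :0 := d) refl _)))

    vᵃ vᵇ : ℕ → ℕ → Carrier
    vᵃ i j = a (suc i) (suc j) - slackᵃ i j
    vᵇ i j = b (suc i) (suc j) - slackᵇ i j

    feasibleᵃ : Feasible a vᵃ
    feasibleᵃ = slack⇒feasible pot-a record
      { s-out    = slackᵃ-out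
      ; s-nonneg = λ j i<p → proj₁ (greedy-bounds (q ℕ.∸ j) j i<p)
      ; s-drop   = λ j i<p → proj₁ (drops j i<p)
      }

    feasibleᵇ : Feasible b vᵇ
    feasibleᵇ = slack⇒feasible pot-b record
      { s-out    = slackᵇ-out
      ; s-nonneg = λ j i<p → proj₂ (greedy-bounds (q ℕ.∸ j) j i<p)
      ; s-drop   = λ j i<p → proj₂ (drops j i<p)
      }

    vᵃ+vᵇ≈2v : ∀ i j → vᵃ i j + vᵇ i j ≈ v i j + v i j
    vᵃ+vᵇ≈2v i j = begin
      vᵃ i j + vᵇ i j
        ≈⟨ solve 4 (λ a b s g → (a :- g) :+ (b :- (s :- g)) := (a :+ b) :- s) refl _ _ _ _ ⟩
      (a (suc i) (suc j) + b (suc i) (suc j)) - double (slack i j)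
        ≈⟨ +-congʳ (a+b≈2u (suc i) (suc j)) ⟩
      double (u (suc i) (suc j)) - double (slack i j)
        ≈⟨ solve 2 (λ u v → (u :+ u) :- ((u :- v) :+ (u :- v)) := v :+ v) refl _ _ ⟩
      v i j + v i j ∎

  -- Squares of bar sums over a 0/1 potential

  module SquareBars {u v} (feas : Feasible u v) (u-bit : ∀ {i} j → i ≤ p → IsBit (u i j)) where
    open Feasible feas
    open Squares potential

    -- The difference is an entry of x, which (a) bounds from below by the flow on a diagonal arc.
    v-decreasing : ∀ {i} j → i < p → Nonneg (v i j - v i (suc j))
    v-decreasing j i<p = Nonneg-resp (solve 2 (λ x d → (x :- d) :+ d := x) refl _ _)
      (+-nonneg (v-diagonal j i<p) (u-diagonal j i<p))

    v-nonneg : ∀ {i} j → i < p → Nonneg (v i j)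
    v-nonneg {i} j i<p = go q j (ℕ.m≤m+n q j)
      where
      -- Descending induction on j, starting beyond the last column, where bar sums vanish.
      go : ∀ n j → q ≤ n ℕ.+ j → Nonneg (v i j)
      go zero    j q≤j   = ≈0⇒nonneg (v-out j i<p λ j< → ℕ.≤⇒≯ q≤j (ℕ.≤-trans j< (ℕ.m⊓n≤n _ _)))
      go (suc n) j q≤n+j = Nonneg-resp (solve 2 (λ a b → (a :- b) :+ b := a) refl _ _)
        (+-nonneg (v-decreasing j i<p) (go n (suc j)
          (ℕ.≤-trans q≤n+j (ℕ.≤-reflexive (≡.sym (ℕ.+-suc n j))))))

    v≤1 : ∀ {i} j → i < p → Nonneg (1# - v i j)
    v≤1 j i<p = Nonneg-resp
      (solve 2 (λ u v → (:1 :- u) :+ (u :- v) := :1 :- v) refl _ _)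
      (+-nonneg (u≤1 (suc j) i<p) (v-bar j i<p))

    -- A nonnegative difference of two 0/1 values is again 0 or 1.
    jump-idempotent : ∀ {i} j → i < p → let d = u (suc i) (suc j) - u i (suc j) in d * d ≈ d
    jump-idempotent j i<p = bit⇒idempotent
      (bits-difference-bit (u-bit (suc j) i<p) (u-bit (suc j) (ℕ.<⇒≤ i<p)) (u-diagonal j i<p))

    -- Δ ≥ d ≥ 0 and d = d² give Δ (Δ + 2 e) ≥ d² = d for every e ≥ 0.
    jump-bound : ∀ {Δ d e} → Nonneg (Δ - d) → Nonneg d → d * d ≈ d → Nonneg e →
                 Nonneg (Δ * (Δ + double e) - d)
    jump-bound {Δ} {d} {e} d≤Δ 0≤d d²≈d 0≤e = Nonneg-resp (begin
      (Δ - d) * ((Δ - d) + double d) + double (((Δ - d) + d) * e)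
        ≈⟨ solve 3 (λ Δ d e → (Δ :- d) :* ((Δ :- d) :+ (d :+ d)) :+
                                (((Δ :- d) :+ d) :* e :+ ((Δ :- d) :+ d) :* e) :=
                              Δ :* (Δ :+ (e :+ e)) :- d :* d) refl Δ d e ⟩
      Δ * (Δ + double e) - d * d ≈⟨ +-congˡ (-‿cong d²≈d) ⟩
      Δ * (Δ + double e) - d     ∎)
      (+-nonneg (*-nonneg d≤Δ (+-nonneg d≤Δ (+-nonneg 0≤d 0≤d))) (+-nonneg Δe Δe))
      where
      Δe : Nonneg (((Δ - d) + d) * e)
      Δe = *-nonneg (+-nonneg d≤Δ 0≤d) 0≤e

    -- With Δ = v - v′ for neighbouring bar sums v and v′, the difference of their squares is Δ (Δ +
    -- 2 v′), so `jump-bound` applies with e = v′.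
    square-bars : Feasible u (λ i j → v i j * v i j)
    square-bars = record
      { potential  = potential
      ; v-out      = λ j i<p j≮ → trans (square-cong (v-out j i<p j≮)) 0²≈0
      ; v-bar      = λ j i<p → Nonneg-resp
          (solve 2 (λ u v → (u :- v) :+ v :* (:1 :- v) := u :- v :* v) refl _ _)
          (+-nonneg (v-bar j i<p) (*-nonneg (v-nonneg j i<p) (v≤1 j i<p)))
      ; v-diagonal = λ j i<p → Nonneg-resp
          (+-congʳ (solve 2 (λ v v′ → (v :- v′) :* ((v :- v′) :+ (v′ :+ v′)) :=
                                      v :* v :- v′ :* v′) refl _ _))
          (jump-bound (v-diagonal j i<p) (u-diagonal j i<p) (jump-idempotent j i<p)
            (v-nonneg (suc j) i<p))
      }

    -- Now the difference is Δ (Δ + 2 (1 - v)), so e = 1 - v. As 2v - v² can exceed v, (b) relies on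
    -- u being 0/1: below u = 0 the bar sum vanishes, and below u = 1 the new slack is (1 - v)².
    dual-bars : Feasible u (λ i j → dual-square (v i j))
    dual-bars = record
      { potential  = potential
      ; v-out      = λ j i<p j≮ → trans (dual-square-cong (v-out j i<p j≮)) dual-square-0≈0
      ; v-bar      = λ j i<p → bar (u-bit (suc j) i<p) (v-bar j i<p) (v-nonneg j i<p) (v≤1 j i<p)
      ; v-diagonal = λ j i<p → Nonneg-resp
          (+-congʳ (solve 2 (λ v v′ → (v :- v′) :* ((v :- v′) :+ ((:1 :- v) :+ (:1 :- v))) :=
                                      (v :+ v :- v :* v) :- (v′ :+ v′ :- v′ :* v′)) refl _ _))
          (jump-bound (v-diagonal j i<p) (u-diagonal j i<p) (jump-idempotent j i<p)
            (v≤1 j i<p))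
      }
      where
      bar : ∀ {u v} → IsBit u → Nonneg (u - v) → Nonneg v → Nonneg (1# - v) →
            Nonneg (u - dual-square v)
      bar {u} {v} (inj₁ u≈0) v≤u 0≤v _ = ≈0⇒nonneg
        (difference-≈0 u≈0 (trans (dual-square-cong v≈0) dual-square-0≈0))
        where
        v≈0 : v ≈ 0#
        v≈0 = antisym (≤-respʳ-≈ u≈0 (nonneg⇒≤ v≤u)) 0≤v
      bar (inj₂ u≈1) _ _ v≤1 = Nonneg-resp
        (trans (solve 1 (λ v → (:1 :- v) :* (:1 :- v) := :1 :- (v :+ v :- v :* v)) refl _)
          (+-congʳ (sym u≈1)))
        (*-nonneg v≤1 v≤1)

  -- Every coordinate of a point is constant or a difference of two table entries, so averages of
  -- tables carry over.
  point-average : ∀ {u v a vᵃ b vᵇ} → (∀ i j → a i j + b i j ≈ u i j + u i j) →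
    (∀ i j → vᵃ i j + vᵇ i j ≈ v i j + v i j) →
    ∀ e → point a vᵃ e + point b vᵇ e ≈ point u v e + point u v e
  point-average {u} {v} {a} {vᵃ} {b} {vᵇ} a+b≈2u vᵃ+vᵇ≈2v = λ
    { (inj₁ e)                  → average (vᵃ+vᵇ≈2v _ _) (vᵃ+vᵇ≈2v _ _)
    ; (inj₂ (vertical _ _ _ _)) → average (a+b≈2u _ _) (a+b≈2u _ _)
    ; (inj₂ (diagonal _ _ _ _)) → average (a+b≈2u _ _) (a+b≈2u _ _)
    ; (inj₂ source)             → refl
    ; (inj₂ (sink _ _))         → average (a+b≈2u _ _) (a+b≈2u _ _)
    }
    where
    average : ∀ {x x′ y y′ z z′} → x + y ≈ z + z → x′ + y′ ≈ z′ + z′ →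
              (x - x′) + (y - y′) ≈ (z - z′) + (z - z′)
    average {x} {x′} {y} {y′} {z} {z′} x+y≈2z x′+y′≈2z′ = begin
      (x - x′) + (y - y′) ≈⟨ solve 4 (λ x x′ y y′ → (x :- x′) :+ (y :- y′) :=
                                        (x :+ y) :- (x′ :+ y′)) refl _ _ _ _ ⟩
      (x + y) - (x′ + y′) ≈⟨ +-cong x+y≈2z (-‿cong x′+y′≈2z′) ⟩
      (z + z) - (z′ + z′) ≈⟨ solve 2 (λ z z′ → (z :+ z) :- (z′ :+ z′) :=
                                        (z :- z′) :+ (z :- z′)) refl _ _ ⟩
      (z - z′) + (z - z′) ∎

  -- Extremality and integrality

  module Vertex {z : I ⊎ Arc → Carrier} (vertex : IsVertex P z) where
    open FromPoint (proj₁ vertex)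

    -- Two feasible pairs of tables with average (u , v) give two points of `P` with midpoint `z`.
    -- At a vertex both points are `z`, and column inflows and bar sums turn this into equations
    -- between tables.
    extreme : ∀ {a vᵃ b vᵇ} → Feasible a vᵃ → Feasible b vᵇ →
      (∀ i j → a i j + b i j ≈ u i j + u i j) → (∀ i j → vᵃ i j + vᵇ i j ≈ v i j + v i j) →
      (∀ {i} j → i ≤ p → a i j ≈ u i j) × (∀ {i} j → i < p → vᵃ i j ≈ v i j)
    extreme feasᵃ feasᵇ a+b≈2u vᵃ+vᵇ≈2v =
      (λ {i} j i≤p → trans (sym (Pointᵃ.columnInflow-point j i≤p))
        (columnInflow-cong (≈z ∘ inj₂) i j)) ,
      (λ {i} j i<p → trans (sym (Pointᵃ.barSum-point j i<p))
        (barSum-cong (≈z ∘ inj₁) i j))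
      where
      module Pointᵃ = ToPoint feasᵃ
      module Pointᵇ = ToPoint feasᵇ
      ≈z = proj₁ (proj₂ vertex _ _ h Pointᵃ.point∈P Pointᵇ.point∈P 0<h h<1 λ e →
        midpoint (trans (point-average a+b≈2u vᵃ+vᵇ≈2v e)
          (+-cong (sym (is-point e)) (sym (is-point e)))))

    -- Here the bar sums are split along with u, and extremality gives u² ≈ u.
    u-bit : ∀ {i} j → i ≤ p → IsBit (u i j)
    u-bit j i≤p = idempotent⇒bit (proj₁
      (extreme feasibleᵃ feasibleᵇ (λ i j → squares-average (u i j)) vᵃ+vᵇ≈2v) j i≤p)
      where
      open Squares (Feasible.potential feasible)
      open Split feasible square dual (λ i j → squares-average (u i j))

    -- Both feasible pairs keep u itself, and only the bar sums are perturbed.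
    v-bit : ∀ {i} j → i < p → IsBit (v i j)
    v-bit j i<p = idempotent⇒bit (proj₂
      (extreme square-bars dual-bars (λ _ _ → refl) (λ i j → squares-average (v i j))) j i<p)
      where open SquareBars feasible u-bit

    point-integer : ∀ e → ∃ λ k → point u v e ≈ fromℤ k
    point-integer (inj₁ e) with element-view i<p _ ≡.refl ← view e =
      bits-difference-integer (v-bit _ i<p) (v-bit _ i<p)
    point-integer (inj₂ (vertical i j i<p _)) = let i<p = recompute (i <? p) i<p in
      bits-difference-integer (u-bit j (ℕ.<⇒≤ i<p)) (u-bit (suc j) i<p)
    point-integer (inj₂ (diagonal i j i<p _)) = let i<p = recompute (i <? p) i<p in
      bits-difference-integer (u-bit (suc j) i<p) (u-bit (suc j) (ℕ.<⇒≤ i<p))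
    point-integer (inj₂ source) = + 1 , sym (+-identityʳ 1#)
    point-integer (inj₂ (sink j _)) =
      bits-difference-integer (u-bit j ℕ.≤-refl) (u-bit (suc j) ℕ.≤-refl)

    integer : IsIntegerPoint z
    integer e with k , point≈k ← point-integer e = k , trans (is-point e) point≈k

theorem4 : ∀ {c ℓ₁ ℓ₂} (K : OrderedField c ℓ₁ ℓ₂) (p q : ℕ) → 1 ≤ q → (q≤p : q ≤ p) →
    Polyhedra.IsIntegral K (Polytope.P K p q q≤p)
theorem4 K p q _ q≤p z vertex = Integrality.Vertex.integer K p q q≤p vertex
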